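{- Let $SG$ be a signed intersection graph. Then the intersection polynomial $IP_{SG}(z)$ has a non-zero constant term if and only if $SG$ is positive (every vertex has sign $+$) and bipartite.
   Context: Ribbon graphs are finite, possibly non-orientable. For a ribbon graph $G$, let $v(G),e(G),f(G)$ be its numbers of vertices, edges and boundary components. For connected $G$ the Euler genus $\varepsilon(G)$ is defined by $2-\varepsilon(G)=v(G)-e(G)+f(G)$. For $A\subseteq E(G)$ the partial dual $G^{A}$ is obtained as follows: take the spanning ribbon subgraph $(V(G),A)$, glue a disc to $G$ along each boundary component of this subgraph (these discs are the vertex-discs of $G^A$), and remove the interiors of all vertex-discs of $G$; the edge-ribbons are kept as the edges of $G^A$. The partial-dual Euler genus polynomial of $G$ is ${}^{\partial}\varepsilon_{G}(z)=\sum_{A\subseteq E(G)}z^{\varepsilon(G^{A})}$. A bouquet is a ribbon graph with exactly one vertex. A loop $e$ at the vertex-disc $v$ is twisted if $e\cup v$ is homeomorphic to a Möbius band, and untwisted otherwise. The intersection graph $I(B)$ of a bouquet $B$ is the graph with vertex set $E(B)$ in which distinct $e$ and $f$ are adjacent if and only if their ends are met in the cyclic order $e\cdots f\cdots e\cdots f\cdots$ when travelling around the boundary of the unique vertex of $B$. The signed intersection graph $SI(B)$ is $I(B)$ together with a sign at each vertex: $+$ if the corresponding edge of $B$ is an untwisted loop, $-$ if it is a twisted loop. A graph $SG$ with a sign $+$ or $-$ at each vertex is called a signed intersection graph if $SG=SI(B)$ for some bouquet $B$. Its intersection polynomial is $IP_{SG}(z):={}^{\partial}\varepsilon_{B}(z)$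 for any bouquet $B$ with $SG=SI(B)$; this does not depend on the choice of $B$, since bouquets with the same signed intersection graph have the same partial-dual Euler genus polynomial. -}

module Defs where

open import Algebra.Definitions using (Involutive)
open import Data.Bool using (Bool; true; false; not; if_then_else_)
import Data.Bool.Properties as Bool
open import Data.Fin using (Fin)
import Data.Fin.Properties as Fin
open import Data.Fin.Subset using (Subset; inside; outside; ⊤; ⁅_⁆)
open import Data.Integer as ℤ using (ℤ; +_; 0ℤ)
open import Data.List using (List; []; _∷_; _++_; map; length; deduplicate; allFin; cartesianProduct)
open import Data.List.Membership.Propositional using (_∈_)
open import Data.List.Membership.Propositional.Properties
  using (∈-map⁺; ∈-map⁻; ∈-++⁺ˡ; ∈-++⁺ʳ; ∈-++⁻; ∈-allFin; ∈-cartesianProduct⁺)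
open import Data.List.Relation.Unary.Any using (here; there)
open import Data.Nat as ℕ using (ℕ; zero; suc; _+_; _∸_; _<_)
import Data.Nat.Properties as ℕ
open import Data.Nat.ListAction using (sum)
open import Data.Nat.GeneralisedArithmetic using (fold; fold-+)
open import Data.Product using (Σ-syntax; _×_; _,_; proj₁; proj₂)
open import Data.Product.Properties using (≡-dec)
open import Data.Sign as Sign using (Sign)
open import Data.Sum using (_⊎_; inj₁; inj₂)
open import Data.Vec as Vec using (lookup)
open import Function using (_∘_; _⇔_; _↔_; Inverse)
open import Level using (0ℓ)
open import Relation.Binary using (Rel; DecidableEquality; Decidable; Symmetric; Irreflexive)
open import Relation.Binary.Construct.Closure.Equivalence as EqC using (EqClosure)
open import Relation.Binary.Construct.Closure.ReflexiveTransitive using (ε; _◅_; _◅◅_)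
open import Relation.Binary.Construct.Closure.Symmetric using (fwd; bwd)
open import Relation.Binary.PropositionalEquality
open import Relation.Nullary using (Dec; ⌊_⌋; _×-dec_; _⊎-dec_)
open import Relation.Nullary.Decidable using (map′)

module _ {X : Set} where

  Generates : (f g : X → X) → Rel X 0ℓ
  Generates f g x y = f x ≡ y ⊎ g x ≡ y

  SameOrbit : (f g : X → X) → Rel X 0ℓ
  SameOrbit f g = EqClosure (Generates f g)

  private
    Listed : List (X × X) → Rel X 0ℓ
    Listed ps x y = (x , y) ∈ ps

  module _ (_≟_ : DecidableEquality X) where

    private
      -- Adding one pair (a , b) to the generators joins the classes of a and b.
      listed? : ∀ ps → Decidable (EqClosure (Listed ps))
      listed? [] x y = map′ (λ { refl → ε }) empty (x ≟ y)
        where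
        empty : ∀ {x y} → EqClosure (Listed []) x y → x ≡ y
        empty ε = refl
        empty (fwd () ◅ _)
        empty (bwd () ◅ _)
      listed? ((a , b) ∷ ps) x y =
        map′ from to
          (x ∼? y ⊎-dec ((x ∼? a ×-dec b ∼? y) ⊎-dec (x ∼? b ×-dec a ∼? y)))
        where
        _∼_ = EqClosure (Listed ps)
        _∼?_ = listed? ps
        _∼⁺_ = EqClosure (Listed ((a , b) ∷ ps))

        Joined : X → X → Set
        Joined x y = x ∼ y ⊎ (x ∼ a × b ∼ y) ⊎ (x ∼ b × a ∼ y)

        weaken : ∀ {x y} → x ∼ y → x ∼⁺ y
        weaken = EqC.map there

        from : ∀ {x y} → Joined x y → x ∼⁺ y
        from (inj₁ p)              = weaken p
        from (inj₂ (inj₁ (p , q))) = weaken p ◅◅ (fwd (here refl) ◅ weaken q)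
        from (inj₂ (inj₂ (p , q))) = weaken p ◅◅ (bwd (here refl) ◅ weaken q)

        prepend : ∀ {x y z} → x ∼ y → Joined y z → Joined x z
        prepend r (inj₁ p)              = inj₁ (r ◅◅ p)
        prepend r (inj₂ (inj₁ (p , q))) = inj₂ (inj₁ (r ◅◅ p , q))
        prepend r (inj₂ (inj₂ (p , q))) = inj₂ (inj₂ (r ◅◅ p , q))

        ab : ∀ {z} → Joined b z → Joined a z
        ab (inj₁ p)              = inj₂ (inj₁ (ε , p))
        ab (inj₂ (inj₁ (_ , q))) = inj₂ (inj₁ (ε , q))
        ab (inj₂ (inj₂ (_ , q))) = inj₁ q

        ba : ∀ {z} → Joined a z → Joined b z
        ba (inj₁ p)              = inj₂ (inj₂ (ε , p))
        ba (inj₂ (inj₁ (_ , q))) = inj₁ q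
        ba (inj₂ (inj₂ (_ , q))) = inj₂ (inj₂ (ε , q))

        to : ∀ {x y} → x ∼⁺ y → Joined x y
        to ε                        = inj₁ ε
        to (fwd (here refl) ◅ rest) = ab (to rest)
        to (fwd (there p)   ◅ rest) = prepend (fwd p ◅ ε) (to rest)
        to (bwd (here refl) ◅ rest) = ba (to rest)
        to (bwd (there p)   ◅ rest) = prepend (bwd p ◅ ε) (to rest)

    module _ {xs : List X} (complete : ∀ x → x ∈ xs) where

      sameOrbit? : (f g : X → X) → Decidable (SameOrbit f g)
      sameOrbit? f g x y = map′ (EqC.map from) (EqC.map to) (listed? pairs x y)
        where
        graph : (X → X) → List (X × X)
        graph h = map (λ x → x , h x) xs

        pairs : List (X × X)
        pairs = graph f ++ graph g

        from : ∀ {x y} → (x , y) ∈ pairs → Generates f g x y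
        from p with ∈-++⁻ (graph f) p
        ... | inj₁ q with _ , _ , refl ← ∈-map⁻ _ q = inj₁ refl
        ... | inj₂ q with _ , _ , refl ← ∈-map⁻ _ q = inj₂ refl

        to : ∀ {x y} → Generates f g x y → (x , y) ∈ pairs
        to (inj₁ refl) = ∈-++⁺ˡ (∈-map⁺ _ (complete _))
        to (inj₂ refl) = ∈-++⁺ʳ (graph f) (∈-map⁺ _ (complete _))

      orbits : (f g : X → X) → ℕ
      orbits f g = length (deduplicate (sameOrbit? f g) xs)

-- An edge-ribbon is a rectangle.  Two opposite edges of the rectangle are its
-- ends, attached to vertex-discs; the other two are its sides.  The corner
-- (e , i , s) is the point of ribbon e where end i meets side s.

Corner : ℕ → Set
Corner n = Fin n × Bool × Bool

edge : ∀ {n} → Corner n → Fin n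
edge = proj₁

acrossEnd : ∀ {n} → Corner n → Corner n
acrossEnd (e , i , s) = e , i , not s

alongSide : ∀ {n} → Corner n → Corner n
alongSide (e , i , s) = e , not i , s

_≟ᶜ_ : ∀ {n} → DecidableEquality (Corner n)
_≟ᶜ_ = ≡-dec Fin._≟_ (≡-dec Bool._≟_ Bool._≟_)

corners : ∀ n → List (Corner n)
corners n = cartesianProduct (allFin n) (cartesianProduct bools bools)
  where
  bools : List Bool
  bools = false ∷ true ∷ []

∈-corners : ∀ {n} (c : Corner n) → c ∈ corners n
∈-corners (e , i , s) =
  ∈-cartesianProduct⁺ (∈-allFin e) (∈-cartesianProduct⁺ (∈-bools i) (∈-bools s))
  where
  ∈-bools : ∀ b → b ∈ false ∷ true ∷ []
  ∈-bools false = here refl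
  ∈-bools true  = there (here refl)

cornerOrbits : ∀ {n} (f g : Corner n → Corner n) → ℕ
cornerOrbits = orbits _≟ᶜ_ ∈-corners

-- Removing the ribbon ends from the boundaries of the vertex-discs leaves arcs,
-- each joining two corners, and one full circle for each vertex-disc that meets
-- no ribbon.  `arc` sends a corner to the other endpoint of its arc.  Vertices
-- may lie on several components, and no orientation is chosen.

record RibbonGraph : Set where
  field
    e[_]           : ℕ
    arc            : Corner e[_] → Corner e[_]
    arc-involutive : Involutive _≡_ arc
    arc-fixed-free : ∀ c → arc c ≢ c
    isolated       : ℕ

open RibbonGraph public

-- The boundary of a vertex-disc alternates between arcs and ribbon ends.
v[_] : RibbonGraph → ℕ
v[ G ] = isolated G + cornerOrbits (arc G) acrossEnd

-- The boundary of (V(G), A) follows the sides of the ribbons in A, and runs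
-- along the vertex-disc where an end of a ribbon not in A was attached.
turn : ∀ {n} → Subset n → Corner n → Corner n
turn A c = if lookup A (edge c) then alongSide c else acrossEnd c

boundaryComponents : (G : RibbonGraph) → Subset e[ G ] → ℕ
boundaryComponents G A = isolated G + cornerOrbits (arc G) (turn A)

f[_] : RibbonGraph → ℕ
f[ G ] = boundaryComponents G ⊤

-- Only meaningful for connected G.
eulerGenus : RibbonGraph → ℤ
eulerGenus G = + 2 ℤ.- (+ v[ G ] ℤ.- + e[ G ] ℤ.+ + f[ G ])

-- In G^A the ribbons of A are attached to the new vertex-discs along their
-- former sides, so `exchange A` translates between the corner names used in G
-- and those used in G^A.  The arcs themselves are unchanged.
exchange : ∀ {n} → Subset n → Corner n → Corner n
exchange A (e , i , s) = if lookup A e then (e , s , i) else (e , i , s)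

exchange-involutive : ∀ {n} (A : Subset n) → Involutive _≡_ (exchange A)
exchange-involutive A (e , i , s) with lookup A e in eq
... | true  rewrite eq = refl
... | false rewrite eq = refl

partialDual : (G : RibbonGraph) → Subset e[ G ] → RibbonGraph
partialDual G A = record
  { e[_]           = e[ G ]
  ; arc            = exchange A ∘ arc G ∘ exchange A
  ; arc-involutive = λ c → begin
      x (a (x (x (a (x c))))) ≡⟨ cong (x ∘ a) (exchange-involutive A _) ⟩
      x (a (a (x c)))         ≡⟨ cong x (arc-involutive G _) ⟩
      x (x c)                 ≡⟨ exchange-involutive A c ⟩
      c                       ∎
  ; arc-fixed-free = λ c xaxc≡c → arc-fixed-free G (x c)
      (trans (sym (exchange-involutive A _)) (cong x xaxc≡c))
  ; isolated       = isolated G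
  }
  where
  open ≡-Reasoning
  x = exchange A
  a = arc G

-- A Laurent polynomial in z with coefficients in ℕ, given by its coefficients.
Polynomial : Set
Polynomial = ℤ → ℕ

z^_ : ℤ → Polynomial
(z^ m) k = if ⌊ m ℤ.≟ k ⌋ then 1 else 0

constantTerm : Polynomial → ℕ
constantTerm p = p 0ℤ

subsets : ∀ n → List (Subset n)
subsets zero    = Vec.[] ∷ []
subsets (suc n) = map (outside Vec.∷_) (subsets n) ++ map (inside Vec.∷_) (subsets n)

∂ε : RibbonGraph → Polynomial
∂ε G k = sum (map (λ A → (z^ eulerGenus (partialDual G A)) k) (subsets e[ G ]))

record Bouquet : Set where
  field
    ribbonGraph : RibbonGraph
    one-vertex  : v[ ribbonGraph ] ≡ 1

open Bouquet public

edges : Bouquet → ℕ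
edges B = e[ ribbonGraph B ]

-- The surface e ∪ v is a disc with one ribbon attached, hence an annulus or a
-- Möbius band; it is the latter when it has a single boundary component.
Twisted : (B : Bouquet) → Fin (edges B) → Set
Twisted B e = boundaryComponents (ribbonGraph B) ⁅ e ⁆ ≡ 1

twisted? : ∀ B e → Dec (Twisted B e)
twisted? B e = boundaryComponents (ribbonGraph B) ⁅ e ⁆ ℕ.≟ 1

-- Travelling along the boundary of a vertex-disc: having reached a ribbon end
-- at corner c, pass along that end and then along the next arc.
step : (G : RibbonGraph) → Corner e[ G ] → Corner e[ G ]
step G = arc G ∘ acrossEnd

walk : (G : RibbonGraph) → Corner e[ G ] → ℕ → Corner e[ G ]
walk G c = fold c (step G)

-- Starting at c, the p ribbon ends met before first returning to c are all the
-- ribbon ends on that vertex-disc, each met exactly once.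
record Circuit (G : RibbonGraph) (c : Corner e[ G ]) (p : ℕ) : Set where
  field
    positive : 0 < p
    closes   : walk G c p ≡ c
    first    : ∀ {m} → 0 < m → m < p → walk G c m ≢ c

record Interlaced (B : Bouquet) (e f : Fin (edges B)) : Set where
  private G = ribbonGraph B
  field
    start       : Corner (edges B)
    {period}    : ℕ
    circuit     : Circuit G start period
    {i j k}     : ℕ
    0<i         : 0 < i
    i<j         : i < j
    j<k         : j < k
    k<period    : k < period
    e-at-0      : edge start ≡ e
    f-at-i      : edge (walk G start i) ≡ f
    e-at-j      : edge (walk G start j) ≡ e
    f-at-k      : edge (walk G start k) ≡ f

module _ (G : RibbonGraph) where

  private
    acrossEnd-involutive : ∀ {n} → Involutive _≡_ (acrossEnd {n})
    acrossEnd-involutive (e , i , s) = cong (λ t → e , i , t) (Bool.not-involutive s)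

  step-injective : ∀ {c d} → step G c ≡ step G d → c ≡ d
  step-injective {c} {d} eq = begin
    c                                 ≡⟨ back c ⟨
    acrossEnd (arc G (step G c))      ≡⟨ cong (acrossEnd ∘ arc G) eq ⟩
    acrossEnd (arc G (step G d))      ≡⟨ back d ⟩
    d                                 ∎
    where
    open ≡-Reasoning
    back : ∀ c → acrossEnd (arc G (step G c)) ≡ c
    back c = trans (cong acrossEnd (arc-involutive G _)) (acrossEnd-involutive c)

  walk-injective : ∀ {c d} n → walk G c n ≡ walk G d n → c ≡ d
  walk-injective zero    eq = eq
  walk-injective (suc n) eq = walk-injective n (step-injective eq)

  walk-+ : ∀ c m n → walk G (walk G c n) m ≡ walk G c (m + n)
  walk-+ c m n = sym (fold-+ c (step G) m)

  walk-comm : ∀ c m n → walk G (walk G c n) m ≡ walk G (walk G c m) n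
  walk-comm c m n = begin
    walk G (walk G c n) m ≡⟨ walk-+ c m n ⟩
    walk G c (m + n)      ≡⟨ cong (walk G c) (ℕ.+-comm m n) ⟩
    walk G c (n + m)      ≡⟨ walk-+ c n m ⟨
    walk G (walk G c m) n ∎
    where open ≡-Reasoning

  rotate : ∀ {c p} i → Circuit G c p → Circuit G (walk G c i) p
  rotate {c} {p} i C = record
    { positive = positive
    ; closes   = trans (walk-comm c p i) (cong (λ d → walk G d i) closes)
    ; first    = λ {m} 0<m m<p eq →
        first 0<m m<p (walk-injective i (trans (sym (walk-comm c m i)) eq))
    }
    where open Circuit C

Interlaced-sym : ∀ B → Symmetric (Interlaced B)
Interlaced-sym B {e} {f} I = record
  { start    = walk G start i
  ; circuit  = rotate G i circuit
  ; i        = j ∸ i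
  ; j        = k ∸ i
  ; k        = period ∸ i
  ; 0<i      = ℕ.m<n⇒0<n∸m i<j
  ; i<j      = ℕ.∸-monoˡ-< j<k (ℕ.<⇒≤ i<j)
  ; j<k      = ℕ.∸-monoˡ-< k<period (ℕ.<⇒≤ i<k)
  ; k<period = ℕ.∸-monoʳ-< 0<i (ℕ.<⇒≤ i<p)
  ; e-at-0   = f-at-i
  ; f-at-i   = trans (cong edge (shift i<j)) e-at-j
  ; e-at-j   = trans (cong edge (shift i<k)) f-at-k
  ; f-at-k   = trans (cong edge (trans (shift i<p) (Circuit.closes circuit))) e-at-0
  }
  where
  open Interlaced I
  G = ribbonGraph B
  i<k = ℕ.<-trans i<j j<k
  i<p = ℕ.<-trans i<k k<period

  shift : ∀ {m} → i < m → walk G (walk G start i) (m ∸ i) ≡ walk G start m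
  shift {m} i<m =
    trans (walk-+ G start (m ∸ i) i) (cong (walk G start) (ℕ.m∸n+n≡m (ℕ.<⇒≤ i<m)))

record SignedGraph : Set₁ where
  field
    order      : ℕ
    Adj        : Rel (Fin order) 0ℓ
    Adj-sym    : Symmetric Adj
    Adj-irrefl : Irreflexive _≡_ Adj
    sign       : Fin order → Sign

open SignedGraph public

SI : Bouquet → SignedGraph
SI B = record
  { order      = edges B
  ; Adj        = λ e f → e ≢ f × Interlaced B e f
  ; Adj-sym    = λ (e≢f , I) → e≢f ∘ sym , Interlaced-sym B I
  ; Adj-irrefl = λ e≡f (e≢f , _) → e≢f e≡f
  ; sign       = λ e → if ⌊ twisted? B e ⌋ then Sign.- else Sign.+
  }

record _≅_ (S T : SignedGraph) : Set where
  field
    vertices : Fin (order S) ↔ Fin (order T)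
  open Inverse vertices public using (to)
  field
    adj-⇔  : ∀ u v → Adj S u v ⇔ Adj T (to u) (to v)
    sign-≡ : ∀ u → sign S u ≡ sign T (to u)

Positive : SignedGraph → Set
Positive S = ∀ v → sign S v ≡ Sign.+

Bipartite : SignedGraph → Set
Bipartite S = Σ[ colour ∈ (Fin (order S) → Bool) ]
  (∀ {u v} → Adj S u v → colour u ≢ colour v)

IsSignedIntersectionGraph : SignedGraph → Set
IsSignedIntersectionGraph S = Σ[ B ∈ Bouquet ] S ≅ SI B

-- The value is read off from the given bouquet; a statement about IP that is
-- quantified over all witnesses therefore holds for every choice of bouquet.
IP : (S : SignedGraph) → IsSignedIntersectionGraph S → Polynomial
IP S (B , _) = ∂ε (ribbonGraph B)

{-# OPTIONS --safe #-}

-- With v(G^A) = f(V , A) and f(G^A) = f(V , E ∖ A), the Euler genus of G^A vanishes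
-- exactly when f(V , A) + f(V , E ∖ A) = |E| + 2.  Inserting a ribbon changes the number of
-- boundary components by at most one, so f(V , A) ≤ |A| + 1 for a bouquet, and both A and
-- E ∖ A must attain the bound.  Equality is inherited by subsets of A, and it fails for a
-- twisted loop and for two interlaced loops.  Conversely, in a set A of untwisted, pairwise
-- non-interlaced loops, every e ∈ A has both ends on one boundary component of
-- (V , A ∖ e), while the chord e separates the circle, so e contributes a new component.
-- Hence the constant term counts the 2-colourings of SI(B) when all signs are positive.

module Submission where

open import Defs
open import Data.Bool using (Bool; true; false; not; if_then_else_)
import Data.Bool.Properties as Bool
open import Data.Fin using (Fin; zero; suc; toℕ)
import Data.Fin.Properties as Fin
open import Data.Fin.Subset
  using (Subset; inside; outside; _∈_; _∉_; _⊆_; _⊂_; ⊥; ⊤; ⁅_⁆; _∪_; _─_; _-_; ∁; ∣_∣)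
open import Data.Fin.Subset.Induction using (⊂-wellFounded)
open import Data.Fin.Subset.Properties
open import Data.Integer as ℤ using (0ℤ)
import Data.Integer.Properties as ℤ
open import Data.Integer.Solver using (module +-*-Solver)
open import Data.List as List using (List; []; _∷_; length; deduplicate)
open import Data.List.Membership.Propositional using (find; lose) renaming (_∈_ to _∈ˡ_)
open import Data.List.Membership.Propositional.Properties using (∈-map⁺; ∈-++⁺ˡ; ∈-++⁺ʳ)
import Data.List.Membership.Setoid.Properties as Setoid
open import Data.List.Properties using (length-removeAt′)
open import Data.List.Relation.Unary.All as All using (All; []; _∷_)
open import Data.List.Relation.Unary.AllPairs using (AllPairs; []; _∷_)
open import Data.List.Relation.Unary.Any as Any using (Any; here; there)
open import Data.List.Relation.Unary.Any.Properties using (lookup-index)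
open import Data.List.Relation.Unary.Unique.DecSetoid.Properties using (deduplicate-!)
open import Data.Nat as ℕ using (ℕ; zero; suc; _+_; _∸_; _≤_; _<_; z≤n; s≤s)
open import Data.Nat.ListAction using (sum)
import Data.Nat.Properties as ℕ
open import Data.Product using (_×_; _,_; ∃; proj₁; proj₂)
open import Data.Sign as Sign using (Sign)
open import Data.Sum using (_⊎_; inj₁; inj₂)
open import Data.Vec using ([]; _∷_; here; there; lookup; tabulate)
open import Data.Vec.Properties
  using ([]=⇒lookup; lookup⇒[]=; lookup-map; lookup-replicate; lookup∘tabulate)
open import Function using (_⇔_; mk⇔; Equivalence; Inverse; _∘_; id)
open import Function.Properties.Equivalence using (⇔-isEquivalence)
open import Induction.WellFounded using (Acc; acc)
open import Level using (0ℓ)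
open import Relation.Binary using (Rel; IsEquivalence; IsDecEquivalence; tri<; tri≈; tri>)
open import Relation.Binary.Construct.Closure.Equivalence as EqC
open import Relation.Binary.PropositionalEquality
  using (_≡_; _≢_; refl; sym; trans; cong; cong₂; subst; subst₂; module ≡-Reasoning)
open import Relation.Nullary using (¬_; Dec; yes; no; contradiction; _×-dec_; ¬?)

-- Counting equivalence classes on a finite list

private
  variable
    X Y Z : Set

remove : {P Q : Z → Set} {zs : List Z} (p : Any P zs) → Any Q zs →
         (∃ λ z → P z × Q z) ⊎ Any Q (zs Any.─ p)
remove (here p)  (here q)  = inj₁ (_ , p , q)
remove (here _)  (there q) = inj₂ q
remove (there _) (here q)  = inj₂ (here q)
remove (there p) (there q) with remove p q
... | inj₁ r = inj₁ r
... | inj₂ r = inj₂ (there r)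

-- A pigeonhole argument: each `y` uses up the entry of `zs` that its proof points to, and a later
-- `y′` needing the same entry would be related to `y`.
unrelated-≤ : {R : Rel Y 0ℓ} {S : Y → Z → Set} → (∀ {y y′ z} → S y z → S y′ z → R y y′) →
              {ys : List Y} {zs : List Z} → AllPairs (λ y y′ → ¬ R y y′) ys →
              All (λ y → Any (S y) zs) ys → length ys ≤ length zs
unrelated-≤ SS⇒R []       []       = z≤n
unrelated-≤ {R = R} {S} SS⇒R {zs = zs} (¬r ∷ ¬rs) (p ∷ ps) =
  subst (_ ≤_) (sym (length-removeAt′ zs (Any.index p)))
    (s≤s (unrelated-≤ SS⇒R ¬rs (All.zipWith leftover (¬r , ps))))
  where
  leftover : ∀ {y′} → ¬ R _ y′ × Any (S y′) zs → Any (S y′) (zs Any.─ p)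
  leftover (¬ryy′ , q) with remove p q
  ... | inj₁ (_ , r , s) = contradiction (SS⇒R r s) ¬ryy′
  ... | inj₂ q′          = q′

module Classes {xs : List X} (complete : ∀ x → x ∈ˡ xs) where

  module _ {R : Rel X 0ℓ} (E : IsDecEquivalence R) where
    private module E = IsDecEquivalence E

    representatives : List X
    representatives = deduplicate E._≟_ xs

    classes : ℕ
    classes = length representatives

    unrelated : AllPairs (λ x y → ¬ R x y) representatives
    unrelated = deduplicate-! (record { isDecEquivalence = E }) xs

    represented : ∀ x → Any (R x) representatives
    represented x =
      Setoid.∈-deduplicate⁺ (record { isEquivalence = E.isEquivalence }) E._≟_
        (λ z≈y x≈y → E.trans x≈y (E.sym z≈y)) (Any.map E.reflexive (complete x))

    classes-positive : X → 1 ≤ classes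
    classes-positive x with representatives | represented x
    ... | _ ∷ _ | _ = s≤s z≤n

    classes≤1⇒related : classes ≤ 1 → ∀ x y → R x y
    classes≤1⇒related k≤1 x y with representatives | represented x | represented y | k≤1
    ... | _ ∷ []    | here p | here q | _      = E.trans p (E.sym q)
    ... | _ ∷ _ ∷ _ | _      | _      | s≤s ()

    module _ (a b : X) where

      Near : X → Set
      Near x = R x a ⊎ R x b

      Merged : Rel X 0ℓ
      Merged x y = R x y ⊎ Near x × Near y

      near-resp : ∀ {x y} → R x y → Near y → Near x
      near-resp r (inj₁ p) = inj₁ (E.trans r p)
      near-resp r (inj₂ p) = inj₂ (E.trans r p)

      merged-isEquivalence : IsEquivalence Merged
      merged-isEquivalence = record { refl = inj₁ E.refl ; sym = symm ; trans = tran }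
        where
        symm : ∀ {x y} → Merged x y → Merged y x
        symm (inj₁ p)       = inj₁ (E.sym p)
        symm (inj₂ (p , q)) = inj₂ (q , p)

        tran : ∀ {x y z} → Merged x y → Merged y z → Merged x z
        tran (inj₁ p)       (inj₁ q)       = inj₁ (E.trans p q)
        tran (inj₁ p)       (inj₂ (q , r)) = inj₂ (near-resp p q , r)
        tran (inj₂ (p , q)) (inj₁ r)       = inj₂ (p , near-resp (E.sym r) q)
        tran (inj₂ (p , q)) (inj₂ (r , s)) = inj₂ (p , s)

  module _ {R R′ : Rel X 0ℓ} (E : IsDecEquivalence R) (E′ : IsDecEquivalence R′) where
    private
      module R  = IsDecEquivalence E
      module R′ = IsDecEquivalence E′

    classes-map : (φ : X → X) → (∀ {x y} → R (φ x) (φ y) → R′ x y) → classes E′ ≤ classes E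
    classes-map φ reflects =
      unrelated-≤ {S = λ x → R (φ x)} (λ p q → reflects (R.trans p (R.sym q)))
        (unrelated E′) (All.universal (represented E ∘ φ) _)

    classes-mono : (∀ {x y} → R x y → R′ x y) → classes E′ ≤ classes E
    classes-mono = classes-map id

    classes-mono-< : (∀ {x y} → R x y → R′ x y) → ∀ {a b} → R′ a b → ¬ R a b → classes E′ < classes E
    classes-mono-< R⇒R′ {a} {b} r′ab ¬rab =
      subst (suc (classes E′) ≤_) (sym (length-removeAt′ (representatives E) (Any.index a∈)))
        (s≤s (unrelated-≤ (λ p q → R′.trans p (R′.sym q)) (unrelated E′) (All.universal cover _)))
      where
      a∈ = represented E a

      b∈ : Any (R b) (representatives E Any.─ a∈)
      b∈ with remove a∈ (represented E b)
      ... | inj₁ (_ , raz , rbz) = contradiction (R.trans raz (R.sym rbz)) ¬rab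
      ... | inj₂ p               = p

      cover : ∀ x → Any (R′ x) (representatives E Any.─ a∈)
      cover x with remove a∈ (represented E x)
      ... | inj₁ (_ , raz , rxz) =
        Any.map (λ rby → R′.trans (R⇒R′ (R.trans rxz (R.sym raz))) (R′.trans r′ab (R⇒R′ rby))) b∈
      ... | inj₂ p               = Any.map R⇒R′ p

    -- Replacing the `R′`-representative of `a` by `a` and `b` gives a list one longer that meets
    -- every `R`-class, since beyond `R` the relation `R′` relates only elements of these two
    -- classes.
    classes-merge : ∀ a b → (∀ {x y} → R′ x y → Merged E a b x y) → classes E ≤ suc (classes E′)
    classes-merge a b R′⇒Merged =
      subst (λ k → classes E ≤ suc k) (sym (length-removeAt′ (representatives E′) (Any.index a∈)))
        (unrelated-≤ (λ p q → R.trans p (R.sym q)) (unrelated E) (All.universal cover _))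
      where
      a∈ = represented E′ a

      near : ∀ {x zs} → Near E a b x → Any (R x) (a ∷ b ∷ zs)
      near (inj₁ p) = here p
      near (inj₂ p) = there (here p)

      near-a : ∀ {x} → Merged E a b x a → Near E a b x
      near-a (inj₁ p)       = inj₁ p
      near-a (inj₂ (p , _)) = p

      split : ∀ {x zs} → Any (R′ x) zs → Any (R x) zs ⊎ Near E a b x
      split (here p) with R′⇒Merged p
      ... | inj₁ q       = inj₁ (here q)
      ... | inj₂ (q , _) = inj₂ q
      split (there p) with split p
      ... | inj₁ q = inj₁ (there q)
      ... | inj₂ q = inj₂ q

      cover : ∀ x → Any (R x) (a ∷ b ∷ (representatives E′ Any.─ a∈))
      cover x with remove a∈ (represented E′ x)
      ... | inj₁ (_ , raz , rxz) = near (near-a (R′⇒Merged (R′.trans rxz (R′.sym raz))))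
      ... | inj₂ p with split p
      ...   | inj₁ q = there (there q)
      ...   | inj₂ q = near q

-- Subsets with one element removed

private
  variable
    n : ℕ
    x y : Fin n
    p q : Subset n

x∈p─q⇒x∉q : x ∈ p ─ q → x ∉ q
x∈p─q⇒x∉q {p = _ ∷ _} {inside ∷ _}  (there x∈p─q) (there x∈q) = x∈p─q⇒x∉q x∈p─q x∈q
x∈p─q⇒x∉q {p = _ ∷ _} {outside ∷ _} (there x∈p─q) (there x∈q) = x∈p─q⇒x∉q x∈p─q x∈q

x∈p-y⇒x∈p : x ∈ p - y → x ∈ p
x∈p-y⇒x∈p {p = p} = p─q⊆p p ⁅ _ ⁆

x∈p-y⇒x≢y : x ∈ p - y → x ≢ y
x∈p-y⇒x≢y {y = y} x∈p-y refl = x∈p─q⇒x∉q x∈p-y (x∈⁅x⁆ y)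

∣p∣≤1+∣p-x∣ : ∀ (p : Subset n) x → ∣ p ∣ ≤ suc ∣ p - x ∣
∣p∣≤1+∣p-x∣ (inside  ∷ p) zero    = s≤s (ℕ.≤-reflexive (cong ∣_∣ (sym (p─⊥≡p p))))
∣p∣≤1+∣p-x∣ (outside ∷ p) zero    = ℕ.m≤n⇒m≤1+n (ℕ.≤-reflexive (cong ∣_∣ (sym (p─⊥≡p p))))
∣p∣≤1+∣p-x∣ (inside  ∷ p) (suc x) = s≤s (∣p∣≤1+∣p-x∣ p x)
∣p∣≤1+∣p-x∣ (outside ∷ p) (suc x) = ∣p∣≤1+∣p-x∣ p x

-- Corners of a ribbon

acrossEnd-involutive : (c : Corner n) → acrossEnd (acrossEnd c) ≡ c
acrossEnd-involutive (e , i , s) = cong (λ t → e , i , t) (Bool.not-involutive s)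

alongSide-involutive : (c : Corner n) → alongSide (alongSide c) ≡ c
alongSide-involutive (e , i , s) = cong (λ t → e , t , s) (Bool.not-involutive i)

data SameRibbon (c : Corner n) : Corner n → Set where
  same     : SameRibbon c c
  across   : SameRibbon c (acrossEnd c)
  along    : SameRibbon c (alongSide c)
  opposite : SameRibbon c (alongSide (acrossEnd c))

sameRibbon : (c d : Corner n) → edge d ≡ edge c → SameRibbon c d
sameRibbon (_ , false , false) (_ , false , false) refl = same
sameRibbon (_ , false , false) (_ , false , true)  refl = across
sameRibbon (_ , false , false) (_ , true  , false) refl = along
sameRibbon (_ , false , false) (_ , true  , true)  refl = opposite
sameRibbon (_ , false , true)  (_ , false , true)  refl = same
sameRibbon (_ , false , true)  (_ , false , false) refl = across
sameRibbon (_ , false , true)  (_ , true  , true)  refl = along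
sameRibbon (_ , false , true)  (_ , true  , false) refl = opposite
sameRibbon (_ , true  , false) (_ , true  , false) refl = same
sameRibbon (_ , true  , false) (_ , true  , true)  refl = across
sameRibbon (_ , true  , false) (_ , false , false) refl = along
sameRibbon (_ , true  , false) (_ , false , true)  refl = opposite
sameRibbon (_ , true  , true)  (_ , true  , true)  refl = same
sameRibbon (_ , true  , true)  (_ , true  , false) refl = across
sameRibbon (_ , true  , true)  (_ , false , true)  refl = along
sameRibbon (_ , true  , true)  (_ , false , false) refl = opposite

turn-∈ : {A : Subset n} {c : Corner n} → edge c ∈ A → turn A c ≡ alongSide c
turn-∈ {c = c} c∈A = cong (λ b → if b then alongSide c else acrossEnd c) ([]=⇒lookup c∈A)

turn-∉ : {A : Subset n} {c : Corner n} → edge c ∉ A → turn A c ≡ acrossEnd c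
turn-∉ {A = A} {c} c∉A with lookup A (edge c) in eq
... | true  = contradiction (lookup⇒[]= (edge c) A eq) c∉A
... | false = refl

sameOrbit-isDecEquivalence : (f g : Corner n → Corner n) → IsDecEquivalence (SameOrbit f g)
sameOrbit-isDecEquivalence f g = record
  { isEquivalence = EqC.isEquivalence _
  ; _≟_           = sameOrbit? _≟ᶜ_ ∈-corners f g
  }

module _ {n : ℕ} where
  open Classes (∈-corners {n}) public

-- Boundary components when a ribbon is removed

module Boundary (G : RibbonGraph) where

  private
    a = arc G

  infix 4 _∼[_]_

  _∼[_]_ : Corner e[ G ] → Subset e[ G ] → Corner e[ G ] → Set
  c ∼[ A ] d = SameOrbit a (turn A) c d

  decE : (A : Subset e[ G ]) → IsDecEquivalence _∼[ A ]_
  decE A = sameOrbit-isDecEquivalence a (turn A)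

  module Orbits (A : Subset e[ G ]) where
    open IsDecEquivalence (decE A) public
      using () renaming (refl to ∼-refl; sym to ∼-sym; trans to ∼-trans; reflexive to ∼-reflexive)

    arc∼ : ∀ c → c ∼[ A ] a c
    arc∼ c = EqC.return (inj₁ refl)

    along∼ : ∀ c → edge c ∈ A → c ∼[ A ] alongSide c
    along∼ c c∈A = EqC.return (inj₂ (turn-∈ c∈A))

    across∼ : ∀ c → edge c ∉ A → c ∼[ A ] acrossEnd c
    across∼ c c∉A = EqC.return (inj₂ (turn-∉ c∉A))

    ∼-fold : {R : Rel (Corner e[ G ]) 0ℓ} → IsEquivalence R → (∀ c → R c (a c)) →
             (∀ c → edge c ∈ A → R c (alongSide c)) → (∀ c → edge c ∉ A → R c (acrossEnd c)) →
             ∀ {c d} → c ∼[ A ] d → R c d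
    ∼-fold {R} E R-arc R-along R-across = EqC.fold E gen
      where
      gen : ∀ {c d} → Generates a (turn A) c d → R c d
      gen (inj₁ refl) = R-arc _
      gen {c} (inj₂ refl) with edge c ∈? A
      ... | yes c∈A = subst (R c) (sym (turn-∈ c∈A)) (R-along c c∈A)
      ... | no  c∉A = subst (R c) (sym (turn-∉ c∉A)) (R-across c c∉A)

  module _ {A : Subset e[ G ]} {c : Corner e[ G ]} where

    private
      e = edge c

    open Orbits A

    -- The two boundaries differ only at ribbon `e`. For `A` its sides put its four corners into at
    -- most two classes, those of `c` and `acrossEnd c`, and crossing its ends instead can only fuse
    -- these two.
    remove-merges : edge c ∈ A → ∀ {d d′} → d ∼[ A - e ] d′ → Merged (decE A) c (acrossEnd c) d d′
    remove-merges c∈A = Orbits.∼-fold (A - e)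
      (merged-isEquivalence (decE A) c (acrossEnd c))
      (λ d → inj₁ (arc∼ d))
      (λ d d∈ → inj₁ (along∼ d (x∈p-y⇒x∈p d∈)))
      across′
      where
      near : ∀ {d} → SameRibbon c d → Near (decE A) c (acrossEnd c) d
      near same     = inj₁ ∼-refl
      near across   = inj₂ ∼-refl
      near along    = inj₁ (∼-sym (along∼ c c∈A))
      near opposite = inj₂ (∼-sym (along∼ (acrossEnd c) c∈A))

      across′ : ∀ d → edge d ∉ A - e → Merged (decE A) c (acrossEnd c) d (acrossEnd d)
      across′ d d∉ with edge d Fin.≟ e
      ... | yes d≡e = inj₂ (near (sameRibbon c d d≡e) , near (sameRibbon c (acrossEnd d) d≡e))
      ... | no  d≢e = inj₁ (across∼ d (λ d∈A → d∉ (x∈p∧x≢y⇒x∈p-y d∈A d≢e)))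

  bc : Subset e[ G ] → ℕ
  bc = boundaryComponents G

  bc-remove : ∀ {A e} → e ∈ A → bc A ≤ suc (bc (A - e))
  bc-remove {A} {e} e∈A = begin
    isolated G + _       ≤⟨ ℕ.+-monoʳ-≤ (isolated G) merge ⟩
    isolated G + suc _   ≡⟨ ℕ.+-suc (isolated G) _ ⟩
    suc (bc (A - e))     ∎
    where
    open ℕ.≤-Reasoning
    c = e , false , false
    merge = classes-merge (decE A) (decE (A - e)) c (acrossEnd c) (remove-merges e∈A)

  -- Removing a ribbon lowers the cardinality by one and `bc` by at most one, so the defect `∣ A ∣`
  -- minus `bc A` never drops as `A` grows. Writing it with sums avoids truncated subtraction.
  bc-mono : ∀ {A A′} → A′ ⊆ A → bc A + ∣ A′ ∣ ≤ bc A′ + ∣ A ∣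
  bc-mono {A} {A′} = go (⊂-wellFounded A)
    where
    open ℕ.≤-Reasoning
    go : ∀ {A} → Acc _⊂_ A → A′ ⊆ A → bc A + ∣ A′ ∣ ≤ bc A′ + ∣ A ∣
    go {A} (acc rec) A′⊆A with Fin.any? (λ e → e ∈? A ×-dec ¬? (e ∈? A′))
    ... | yes (e , e∈A , e∉A′) = begin
      bc A + ∣ A′ ∣             ≤⟨ ℕ.+-monoˡ-≤ _ (bc-remove e∈A) ⟩
      suc (bc (A - e) + ∣ A′ ∣) ≤⟨ s≤s (go (rec (x∈p⇒p-x⊂p e∈A)) A′⊆A-e) ⟩
      suc (bc A′ + ∣ A - e ∣)   ≡⟨ ℕ.+-suc _ _ ⟨
      bc A′ + suc ∣ A - e ∣     ≤⟨ ℕ.+-monoʳ-≤ (bc A′) (x∈p⇒∣p-x∣<∣p∣ e∈A) ⟩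
      bc A′ + ∣ A ∣             ∎
      where
      A′⊆A-e : A′ ⊆ A - e
      A′⊆A-e x∈A′ = x∈p∧x≢y⇒x∈p-y (A′⊆A x∈A′) (λ { refl → e∉A′ x∈A′ })
    ... | no none = ℕ.≤-reflexive
      (trans (cong (λ S → bc S + ∣ A′ ∣) A≡A′) (cong (λ S → bc A′ + ∣ S ∣) (sym A≡A′)))
      where
      A⊆A′ : A ⊆ A′
      A⊆A′ {x} x∈A with x ∈? A′
      ... | yes x∈A′ = x∈A′
      ... | no  x∉A′ = contradiction (x , x∈A , x∉A′) none

      A≡A′ = ⊆-antisym A⊆A′ A′⊆A

  -- When both sides of the ribbon lie on one component, so do all four corners, and crossing its
  -- ends in `A - e` never leaves a class of `A`.
  related⇒bc-remove : ∀ {A} c → edge c ∈ A → c ∼[ A ] acrossEnd c → bc A ≤ bc (A - edge c)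
  related⇒bc-remove {A} c c∈A c∼xc =
    ℕ.+-monoʳ-≤ (isolated G) (classes-mono (decE (A - e)) (decE A)
      (Orbits.∼-fold (A - e) (IsDecEquivalence.isEquivalence (decE A))
        arc∼ (λ d d∈ → along∼ d (x∈p-y⇒x∈p d∈)) across′))
    where
    open Orbits A
    e = edge c

    connected : ∀ {d} → SameRibbon c d → c ∼[ A ] d
    connected same     = ∼-refl
    connected across   = c∼xc
    connected along    = along∼ c c∈A
    connected opposite = ∼-trans c∼xc (along∼ (acrossEnd c) c∈A)

    across′ : ∀ d → edge d ∉ A - e → d ∼[ A ] acrossEnd d
    across′ d d∉ with edge d Fin.≟ e
    ... | yes d≡e =
      ∼-trans (∼-sym (connected (sameRibbon c d d≡e))) (connected (sameRibbon c (acrossEnd d) d≡e))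
    ... | no  d≢e = across∼ d (λ d∈A → d∉ (x∈p∧x≢y⇒x∈p-y d∈A d≢e))

-- Walks around a vertex-disc

cornerIndex : Corner n → Fin (length (corners n))
cornerIndex c = Any.index (∈-corners c)

module Walks (G : RibbonGraph) where

  step-reverse : ∀ c → step G (acrossEnd (step G c)) ≡ acrossEnd c
  step-reverse c =
    trans (cong (arc G) (acrossEnd-involutive (step G c))) (arc-involutive G (acrossEnd c))

  -- A walk from `c` to its flip can be cut by one step at each end, and what remains again joins a
  -- corner to its flip. This ends at length 0 or 1, where `acrossEnd` or `arc` would have a fixed
  -- point.
  walk-no-flip : ∀ m c → walk G c m ≢ acrossEnd c
  walk-no-flip zero          (e , i , s) eq = Bool.not-¬ refl (cong (proj₂ ∘ proj₂) eq)
  walk-no-flip (suc zero)    c eq = arc-fixed-free G (acrossEnd c) eq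
  walk-no-flip (suc (suc m)) c eq = walk-no-flip m (step G c) (step-injective G (begin
    step G (walk G (step G c) m)   ≡⟨ cong (step G) (walk-comm G c m 1) ⟩
    walk G c (suc (suc m))         ≡⟨ eq ⟩
    acrossEnd c                    ≡⟨ step-reverse c ⟨
    step G (acrossEnd (step G c))  ∎))
    where open ≡-Reasoning

  walk-reverse : ∀ l c → walk G (acrossEnd (walk G c l)) l ≡ acrossEnd c
  walk-reverse zero    c = refl
  walk-reverse (suc l) c = begin
    walk G (acrossEnd (walk G c (suc l))) (suc l)          ≡⟨ walk-comm G _ l 1 ⟨
    walk G (step G (acrossEnd (step G (walk G c l)))) l    ≡⟨ cong (λ d → walk G d l) (step-reverse _) ⟩
    walk G (acrossEnd (walk G c l)) l                      ≡⟨ walk-reverse l c ⟩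
    acrossEnd c                                            ∎
    where open ≡-Reasoning

  -- Reversing the walk of length `l` would prolong the other into a walk from `c` to its flip. So
  -- every ribbon end is passed in one direction only.
  walk≢across-walk : ∀ c m l → walk G c m ≢ acrossEnd (walk G c l)
  walk≢across-walk c m l eq = walk-no-flip (l + m) c (begin
    walk G c (l + m)                   ≡⟨ walk-+ G c l m ⟨
    walk G (walk G c m) l              ≡⟨ cong (λ d → walk G d l) eq ⟩
    walk G (acrossEnd (walk G c l)) l  ≡⟨ walk-reverse l c ⟩
    acrossEnd c                        ∎)
    where open ≡-Reasoning

  walk-∸ : ∀ c {m l} → m ≤ l → walk G (walk G c m) (l ∸ m) ≡ walk G c l
  walk-∸ c {m} {l} m≤l = trans (walk-+ G c (l ∸ m) m) (cong (walk G c) (ℕ.m∸n+n≡m m≤l))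

  walk-collision : ∀ c {m l} → m < l → walk G c m ≡ walk G c l → walk G c (l ∸ m) ≡ c
  walk-collision c {m} {l} m<l eq = walk-injective G m (begin
    walk G (walk G c (l ∸ m)) m  ≡⟨ walk-comm G c m (l ∸ m) ⟩
    walk G (walk G c m) (l ∸ m)  ≡⟨ walk-∸ c (ℕ.<⇒≤ m<l) ⟩
    walk G c l                   ≡⟨ eq ⟨
    walk G c m                   ∎)
    where open ≡-Reasoning

  returns : ∀ c → ∃ λ p → 0 < p × walk G c p ≡ c
  -- There is one more position than there are corners, so two positions share a corner; injectivity
  -- of `step` moves the coincidence back to `c`.
  returns c with i , j , i<j , eq ← Fin.pigeonhole (ℕ.n<1+n _) (λ i → cornerIndex (walk G c (toℕ i))) =
    toℕ j ∸ toℕ i , ℕ.m<n⇒0<n∸m i<j , walk-collision c i<j (begin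
      walk G c (toℕ i)
        ≡⟨ lookup-index (∈-corners (walk G c (toℕ i))) ⟩
      List.lookup (corners e[ G ]) (cornerIndex (walk G c (toℕ i)))
        ≡⟨ cong (List.lookup (corners e[ G ])) eq ⟩
      List.lookup (corners e[ G ]) (cornerIndex (walk G c (toℕ j)))
        ≡⟨ lookup-index (∈-corners (walk G c (toℕ j))) ⟨
      walk G c (toℕ j) ∎)
    where open ≡-Reasoning

  -- A linear search: `m` is the current candidate and `k` the remaining fuel, and `p ≤ k + m`
  -- ensures that the known return at `p` is reached in time.
  least-return : ∀ {c p} → 0 < p → walk G c p ≡ c → ∀ k m → 0 < m → p ≤ k + m →
                 (∀ {l} → 0 < l → l < m → walk G c l ≢ c) → ∃ (Circuit G c)
  least-return {c} {p} 0<p closes k m 0<m p≤k+m least = decide k p≤k+m (walk G c m ≟ᶜ c)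
    where
    decide : ∀ k → p ≤ k + m → Dec (walk G c m ≡ c) → ∃ (Circuit G c)
    decide _       _     (yes wm≡c) = m , record { positive = 0<m ; closes = wm≡c ; first = least }
    decide zero    p≤m   (no wm≢c)  with ℕ.m≤n⇒m<n∨m≡n p≤m
    ... | inj₁ p<m  = contradiction closes (least 0<p p<m)
    ... | inj₂ refl = contradiction closes wm≢c
    decide (suc k) p≤    (no wm≢c)  =
      least-return 0<p closes k (suc m) (s≤s z≤n) (subst (p ≤_) (sym (ℕ.+-suc k m)) p≤) least′
      where
      least′ : ∀ {l} → 0 < l → l < suc m → walk G c l ≢ c
      least′ 0<l (s≤s l≤m) with ℕ.m≤n⇒m<n∨m≡n l≤m
      ... | inj₁ l<m  = least 0<l l<m
      ... | inj₂ refl = wm≢c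

  circuit-from : ∀ c → ∃ (Circuit G c)
  circuit-from c = let p , 0<p , closes = returns c in
    least-return 0<p closes p 1 (s≤s z≤n) (ℕ.m≤m+n p 1) λ 0<m m<1 → contradiction 0<m (ℕ.<⇒≱ m<1)

-- Vertices and boundary components of a partial dual

sameOrbit-map : {f g f′ g′ : Corner n → Corner n} (φ : Corner n → Corner n) →
                (∀ c → φ (f c) ≡ f′ (φ c)) → (∀ c → φ (g c) ≡ g′ (φ c)) →
                ∀ {c d} → SameOrbit f g c d → SameOrbit f′ g′ (φ c) (φ d)
sameOrbit-map φ φf φg = EqC.gmap φ λ where
  (inj₁ refl) → inj₁ (sym (φf _))
  (inj₂ refl) → inj₂ (sym (φg _))

module _ {f g f′ g′ : Corner n → Corner n} (φ : Corner n → Corner n) (φφ : ∀ c → φ (φ c) ≡ c)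
         (φf : ∀ c → φ (f c) ≡ f′ (φ c)) (φg : ∀ c → φ (g c) ≡ g′ (φ c)) where

  private
    converse : {h h′ : Corner n → Corner n} → (∀ c → φ (h c) ≡ h′ (φ c)) → ∀ c → φ (h′ c) ≡ h (φ c)
    converse {h} {h′} φh c = begin
      φ (h′ c)         ≡⟨ cong (φ ∘ h′) (φφ c) ⟨
      φ (h′ (φ (φ c))) ≡⟨ cong φ (φh (φ c)) ⟨
      φ (φ (h (φ c)))  ≡⟨ φφ _ ⟩
      h (φ c)          ∎
      where open ≡-Reasoning

    _≈_ _≈′_ : Rel (Corner n) 0ℓ
    _≈_  = SameOrbit f g
    _≈′_ = SameOrbit f′ g′

  cornerOrbits-conjugate : cornerOrbits f g ≡ cornerOrbits f′ g′
  cornerOrbits-conjugate = ℕ.≤-antisym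
    (classes-map (sameOrbit-isDecEquivalence f′ g′) (sameOrbit-isDecEquivalence f g) φ
      λ r → subst₂ _≈_ (φφ _) (φφ _) (sameOrbit-map φ (converse φf) (converse φg) r))
    (classes-map (sameOrbit-isDecEquivalence f g) (sameOrbit-isDecEquivalence f′ g′) φ
      λ r → subst₂ _≈′_ (φφ _) (φφ _) (sameOrbit-map φ φf φg r))

-- A ribbon of `A` is attached in the dual along its former sides, so crossing an end there means
-- following a side in `G`; other ribbons are unchanged.
exchange-acrossEnd : (A : Subset n) (c : Corner n) → exchange A (acrossEnd c) ≡ turn A (exchange A c)
exchange-acrossEnd A (e , i , s) with lookup A e in eq
... | true  rewrite eq = refl
... | false rewrite eq = refl

-- The sides in the dual are former ends exactly for the ribbons of `A`, hence the complement.
exchange-alongSide : (A : Subset n) (c : Corner n) → exchange A (turn ⊤ c) ≡ turn (∁ A) (exchange A c)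
exchange-alongSide A (e , i , s)
  rewrite lookup-replicate e inside with lookup A e in eq
... | true  rewrite lookup-map e not A | eq = refl
... | false rewrite lookup-map e not A | eq = refl

module _ (G : RibbonGraph) (A : Subset e[ G ]) where

  private
    arc-conjugate : ∀ c → exchange A (arc (partialDual G A) c) ≡ arc G (exchange A c)
    arc-conjugate c = exchange-involutive A _

  v-partialDual : v[ partialDual G A ] ≡ boundaryComponents G A
  v-partialDual = cong (isolated G +_)
    (cornerOrbits-conjugate (exchange A) (exchange-involutive A) arc-conjugate (exchange-acrossEnd A))

  f-partialDual : f[ partialDual G A ] ≡ boundaryComponents G (∁ A)
  f-partialDual = cong (isolated G +_)
    (cornerOrbits-conjugate (exchange A) (exchange-involutive A) arc-conjugate (exchange-alongSide A))

-- Plane spanning subgraphs of a bouquet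

turn-involutive : (A : Subset n) (c : Corner n) → turn A (turn A c) ≡ c
turn-involutive A c with edge c ∈? A
... | yes c∈A = trans (cong (turn A) (turn-∈ c∈A)) (trans (turn-∈ c∈A) (alongSide-involutive c))
... | no  c∉A = trans (cong (turn A) (turn-∉ c∉A)) (trans (turn-∉ c∉A) (acrossEnd-involutive c))

-- An involution that preserves `V` also reflects it, so `V` is carried along generators used
-- backwards as well.
orbit-invariant : {f g : X → X} → (∀ c → f (f c) ≡ c) → (∀ c → g (g c) ≡ c) → {V : X → Set} →
                  (∀ {c} → V c → V (f c)) → (∀ {c} → V c → V (g c)) →
                  ∀ {c d} → SameOrbit f g c d → V c → V d
orbit-invariant {f = f} {g} ff gg {V} Vf Vg r = Equivalence.to (EqC.gfold ⇔-isEquivalence V invariant r)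
  where
  invariant : ∀ {c d} → Generates f g c d → V c ⇔ V d
  invariant (inj₁ refl) = mk⇔ Vf (subst V (ff _) ∘ Vf)
  invariant (inj₂ refl) = mk⇔ Vg (subst V (gg _) ∘ Vg)

module Tightness (B : Bouquet) where

  G : RibbonGraph
  G = ribbonGraph B

  open Boundary G

  bc-⊥ : bc ⊥ ≡ 1
  bc-⊥ = trans
    (cong (isolated G +_) (cornerOrbits-conjugate {f = arc G} {f′ = arc G} id
      (λ _ → refl) (λ _ → refl) (λ c → turn-∉ {c = c} ∉⊥)))
    (one-vertex B)

  bc≤1+∣A∣ : ∀ A → bc A ≤ suc ∣ A ∣
  bc≤1+∣A∣ A = begin
    bc A                ≡⟨ ℕ.+-identityʳ _ ⟨
    bc A + 0            ≡⟨ cong (bc A +_) (∣⊥∣≡0 e[ G ]) ⟨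
    bc A + ∣ ⊥ {e[ G ]} ∣ ≤⟨ bc-mono {A} {⊥} (λ x∈⊥ → contradiction x∈⊥ ∉⊥) ⟩
    bc ⊥ + ∣ A ∣        ≡⟨ cong (_+ ∣ A ∣) bc-⊥ ⟩
    suc ∣ A ∣           ∎
    where open ℕ.≤-Reasoning

  -- The spanning ribbon subgraph on A is plane.
  Tight : Subset e[ G ] → Set
  Tight A = suc ∣ A ∣ ≤ bc A

  tight-⊆ : ∀ {A A′} → A′ ⊆ A → Tight A → Tight A′
  tight-⊆ {A} {A′} A′⊆A tight = ℕ.+-cancelʳ-≤ ∣ A ∣ _ _ (begin
    suc ∣ A′ ∣ + ∣ A ∣ ≡⟨ ℕ.+-comm (suc ∣ A′ ∣) ∣ A ∣ ⟩
    ∣ A ∣ + suc ∣ A′ ∣ ≡⟨ ℕ.+-suc ∣ A ∣ ∣ A′ ∣ ⟩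
    suc ∣ A ∣ + ∣ A′ ∣ ≤⟨ ℕ.+-monoˡ-≤ ∣ A′ ∣ tight ⟩
    bc A + ∣ A′ ∣      ≤⟨ bc-mono A′⊆A ⟩
    bc A′ + ∣ A ∣      ∎)
    where open ℕ.≤-Reasoning

  tight-⁅⁆ : ∀ {A e} → e ∈ A → Tight A → Tight ⁅ e ⁆
  tight-⁅⁆ e∈A = tight-⊆ λ x∈⁅e⁆ → subst (_∈ _) (sym (x∈⁅y⁆⇒x≡y _ x∈⁅e⁆)) e∈A

  -- If both sides lay on one component, deleting the ribbon would not lower `bc`, and the bound for
  -- `A - edge c` would give `bc A` at most `∣ A ∣`.
  tight⇒separated : ∀ {A} c → Tight A → edge c ∈ A → ¬ c ∼[ A ] acrossEnd c
  tight⇒separated {A} c tight c∈A c∼xc = ℕ.<-irrefl refl (begin-strict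
    bc A                   ≤⟨ related⇒bc-remove c c∈A c∼xc ⟩
    bc (A - edge c)        ≤⟨ bc≤1+∣A∣ (A - edge c) ⟩
    suc ∣ A - edge c ∣     ≤⟨ x∈p⇒∣p-x∣<∣p∣ c∈A ⟩
    ∣ A ∣                  <⟨ tight ⟩
    bc A                   ∎)
    where open ℕ.≤-Reasoning

  connected : ∀ c d → SameOrbit (arc G) acrossEnd c d
  connected = classes≤1⇒related (sameOrbit-isDecEquivalence (arc G) acrossEnd)
    (ℕ.≤-trans (ℕ.m≤n+m _ (isolated G)) (ℕ.≤-reflexive (one-vertex B)))

-- The vertex circle and its chords

module Circle (B : Bouquet) {c₀ : Corner (edges B)} {p : ℕ}
              (circuit : Circuit (ribbonGraph B) c₀ p) where

  open Tightness B
  open Boundary G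
  open Walks G
  open Circuit circuit

  -- Ribbon ends are addressed by position: the walk reaches end `m` at `P m` and leaves it at
  -- `acrossEnd (P m)`, from where an arc leads to `P (suc m)`.
  P : ℕ → Corner e[ G ]
  P = walk G c₀

  P-≢ : ∀ {l m} → l < m → m < p → P l ≢ P m
  P-≢ {l} {m} l<m m<p eq =
    first (ℕ.m<n⇒0<n∸m l<m) (ℕ.≤-<-trans (ℕ.m∸n≤m m l) m<p) (walk-collision c₀ l<m eq)

  P-injective : ∀ {l m} → l < p → m < p → P l ≡ P m → l ≡ m
  P-injective {l} {m} l<p m<p eq with ℕ.<-cmp l m
  ... | tri< l<m _ _ = contradiction eq (P-≢ l<m m<p)
  ... | tri≈ _ l≡m _ = l≡m
  ... | tri> _ _ m<l = contradiction (sym eq) (P-≢ m<l l<p)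

  P≢acrossEnd-P : ∀ l m → P l ≢ acrossEnd (P m)
  P≢acrossEnd-P = walk≢across-walk c₀

  arc-P-suc : ∀ m → arc G (P (suc m)) ≡ acrossEnd (P m)
  arc-P-suc m = arc-involutive G _

  Visited : Corner e[ G ] → Set
  Visited c = ∃ λ w → w < p × (c ≡ P w ⊎ c ≡ acrossEnd (P w))

  visited : ∀ c → Visited c
  visited c = orbit-invariant (arc-involutive G) acrossEnd-involutive visited-arc visited-across
    (connected c₀ c) (0 , positive , inj₁ refl)
    where
    visited-across : ∀ {d} → Visited d → Visited (acrossEnd d)
    visited-across (w , w<p , inj₁ refl) = w , w<p , inj₂ refl
    visited-across (w , w<p , inj₂ refl) = w , w<p , inj₁ (acrossEnd-involutive _)

    visited-arc : ∀ {d} → Visited d → Visited (arc G d)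
    visited-arc (suc w , w<p , inj₁ refl) = w , ℕ.<-trans (ℕ.n<1+n w) w<p , inj₂ (arc-P-suc w)
    -- Position 0 is reached again as position `p`, so the arc at `c₀` leads back to the last end
    -- before it.
    visited-arc (zero , 0<p , inj₁ refl) = last closes 0<p ℕ.≤-refl
      where
      last : ∀ {q} → P q ≡ c₀ → 0 < q → q ≤ p → Visited (arc G c₀)
      last {suc q} eq _ q<p = q , q<p , inj₂ (trans (cong (arc G) (sym eq)) (arc-P-suc q))
    visited-arc (w , w<p , inj₂ refl) with ℕ.m≤n⇒m<n∨m≡n w<p
    ... | inj₁ w+1<p = suc w , w+1<p , inj₁ refl
    ... | inj₂ refl  = 0 , positive , inj₁ closes

  -- Injectivity of `P` excludes the same corner, and the fixed direction of travel excludes its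
  -- flip. Of the two corners left, `alongSide (P l)` is the twisted case and the other the
  -- untwisted one.
  sameEdge : ∀ {l m} → l < p → m < p → l ≢ m → edge (P m) ≡ edge (P l) →
             P m ≡ alongSide (P l) ⊎ P m ≡ alongSide (acrossEnd (P l))
  sameEdge {l} {m} l<p m<p l≢m eq with P m in eqₘ | sameRibbon (P l) (P m) eq
  ... | _ | same     = contradiction (P-injective l<p m<p (sym eqₘ)) l≢m
  ... | _ | across   = contradiction eqₘ (P≢acrossEnd-P m l)
  ... | _ | along    = inj₁ refl
  ... | _ | opposite = inj₂ refl

  -- Both further positions would lie at the opposite end of the ribbon, whose two corners are flips
  -- of each other, so they would coincide or be passed in opposite directions.
  edge-at-most-twice : ∀ {l m k} → l < p → m < p → k < p → l ≢ m → l ≢ k → m ≢ k →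
                       edge (P m) ≡ edge (P l) → edge (P k) ≢ edge (P l)
  edge-at-most-twice {l} {m} {k} l<p m<p k<p l≢m l≢k m≢k eqₘ eqₖ
    with sameEdge l<p m<p l≢m eqₘ | sameEdge l<p k<p l≢k eqₖ
  ... | inj₁ m≡ | inj₁ k≡ = m≢k (P-injective m<p k<p (trans m≡ (sym k≡)))
  ... | inj₁ m≡ | inj₂ k≡ = P≢acrossEnd-P k m (trans k≡ (cong acrossEnd (sym m≡)))
  ... | inj₂ m≡ | inj₁ k≡ = P≢acrossEnd-P m k (trans m≡ (cong acrossEnd (sym k≡)))
  ... | inj₂ m≡ | inj₂ k≡ = m≢k (P-injective m<p k<p (trans m≡ (sym k≡)))

  module _ (A : Subset e[ G ]) where
    open Orbits A

    -- Ends of ribbons outside `A` are simply crossed, so on a free stretch the boundary keeps to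
    -- the vertex circle.
    run : ∀ {m l} → m < l → (∀ {w} → m < w → w < l → edge (P w) ∉ A) → acrossEnd (P m) ∼[ A ] P l
    run {m} {suc l} (s≤s m≤l) free with ℕ.m≤n⇒m<n∨m≡n m≤l
    ... | inj₂ refl = arc∼ _
    ... | inj₁ m<l  = ∼-trans (run m<l λ m<w w<l → free m<w (ℕ.m<n⇒m<1+n w<l))
                        (∼-trans (across∼ (P l) (free m<l (ℕ.n<1+n l))) (arc∼ _))

  -- An untwisted ribbon joins the ends at positions l and m.
  record Chord (l m : ℕ) : Set where
    constructor joins
    field sides : alongSide (P l) ≡ acrossEnd (P m)

  open Chord public

  chord-edge : ∀ {l m} → Chord l m → edge (P l) ≡ edge (P m)
  chord-edge = cong edge ∘ sides

  chord-opposite : ∀ {l m} → Chord l m → alongSide (acrossEnd (P l)) ≡ P m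
  chord-opposite {m = m} (joins eq) = trans (cong acrossEnd eq) (acrossEnd-involutive (P m))

  chord-sym : ∀ {l m} → Chord l m → Chord m l
  chord-sym ch = joins (trans (cong alongSide (sym (chord-opposite ch))) (alongSide-involutive _))

  chord-unique : ∀ {l m k} → m < p → k < p → Chord l m → Chord l k → m ≡ k
  chord-unique m<p k<p ch ch′ =
    P-injective m<p k<p (trans (sym (chord-opposite ch)) (chord-opposite ch′))

  chord-≢ : ∀ {l m} → Chord l m → l ≢ m
  chord-≢ (joins eq) refl = Bool.not-¬ refl (sym (cong (proj₁ ∘ proj₂) eq))

  -- On a twisted loop the side from `P l` leads to `P m`, and the free stretch between the
  -- positions leads back to `acrossEnd (P l)`. Both sides then share a component, which tightness
  -- forbids.
  tight⇒¬twisted : ∀ {l m e} → Tight ⁅ e ⁆ → l < m → m < p → edge (P l) ≡ e → P m ≢ alongSide (P l)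
  tight⇒¬twisted {l} {m} tight l<m m<p refl eq = tight⇒separated (P l) tight (x∈⁅x⁆ _)
    (∼-trans (along∼ (P l) (x∈⁅x⁆ _)) (∼-trans (∼-reflexive (sym eq)) (∼-sym (run _ l<m free))))
    where
    open Orbits ⁅ edge (P l) ⁆
    free : ∀ {w} → l < w → w < m → edge (P w) ∉ ⁅ edge (P l) ⁆
    free l<w w<m w∈ = edge-at-most-twice (ℕ.<-trans l<m m<p) m<p (ℕ.<-trans w<m m<p)
      (ℕ.<⇒≢ l<m) (ℕ.<⇒≢ l<w) (ℕ.<⇒≢ w<m ∘ sym) (cong edge eq) (x∈⁅y⁆⇒x≡y _ w∈)

  tight⇒chord : ∀ {l m e} → Tight ⁅ e ⁆ → l < p → m < p → l ≢ m →
                edge (P l) ≡ e → edge (P m) ≡ e → Chord l m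
  tight⇒chord {l} {m} tight l<p m<p l≢m eqₗ eqₘ
    with sameEdge l<p m<p l≢m (trans eqₘ (sym eqₗ)) | ℕ.<-cmp l m
  ... | inj₂ opp | _            =
    joins (sym (trans (cong acrossEnd opp) (acrossEnd-involutive (alongSide (P l)))))
  ... | inj₁ tw  | tri< l<m _ _ = contradiction tw (tight⇒¬twisted tight l<m m<p eqₗ)
  ... | inj₁ tw  | tri≈ _ l≡m _ = contradiction l≡m l≢m
  ... | inj₁ tw  | tri> _ _ m<l = contradiction
    (trans (sym (alongSide-involutive (P l))) (cong alongSide (sym tw))) (tight⇒¬twisted tight m<l l<p eqₘ)

  -- The side starting at `P l` ends at a visited corner. If that were some `P m` rather than a
  -- flip, tightness would also make it `acrossEnd (P m)`, a clash of directions.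
  partner : ∀ {l} → Tight ⁅ edge (P l) ⁆ → l < p → ∃ λ m → m < p × Chord l m
  partner {l} tight l<p with visited (alongSide (P l))
  ... | m , m<p , inj₂ eq = m , m<p , joins eq
  ... | m , m<p , inj₁ tw = contradiction
    (trans (sym tw) (sides (tight⇒chord tight l<p m<p l≢m refl (sym (cong edge tw))))) (P≢acrossEnd-P m m)
    where
    l≢m : l ≢ m
    l≢m refl = Bool.not-¬ refl (sym (cong (proj₁ ∘ proj₂) tw))

  crossing⇒interlaced : ∀ {l m l′ m′} → l < m → m < l′ → l′ < m′ → m′ < p →
                        edge (P l) ≡ edge (P l′) → edge (P m) ≡ edge (P m′) →
                        Interlaced B (edge (P l)) (edge (P m))
  crossing⇒interlaced {l} {m} {l′} {m′} l<m m<l′ l′<m′ m′<p eqₗ eqₘ = record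
    { start    = P l
    ; circuit  = rotate G l circuit
    ; 0<i      = ℕ.m<n⇒0<n∸m l<m
    ; i<j      = ℕ.∸-monoˡ-< m<l′ (ℕ.<⇒≤ l<m)
    ; j<k      = ℕ.∸-monoˡ-< l′<m′ (ℕ.<⇒≤ l<l′)
    ; k<period = ℕ.≤-<-trans (ℕ.m∸n≤m m′ l) m′<p
    ; e-at-0   = refl
    ; f-at-i   = cong edge (walk-∸ c₀ (ℕ.<⇒≤ l<m))
    ; e-at-j   = trans (cong edge (walk-∸ c₀ (ℕ.<⇒≤ l<l′))) (sym eqₗ)
    ; f-at-k   = trans (cong edge (walk-∸ c₀ (ℕ.<⇒≤ (ℕ.<-trans l<l′ l′<m′)))) (sym eqₘ)
    }
    where
    l<l′ = ℕ.<-trans l<m m<l′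

-- Planarity criterion for sets of loops

module Criterion (B : Bouquet) where

  open Tightness B
  open Boundary G
  open Walks G

  -- The pair `D` would inherit tightness. Yet its boundary from `P 0` goes along `e` to the end at
  -- `j`, on to `k`, along `f` to `i`, on to `j` and along `e` to `acrossEnd (P 0)`, so both sides
  -- of `e` share a component.
  tight⇒¬interlaced : ∀ {A e f} → Tight A → e ∈ A → f ∈ A → e ≢ f → ¬ Interlaced B e f
  tight⇒¬interlaced {A} {e} {f} tight e∈A f∈A e≢f I =
    tight⇒separated (P 0) tight-D (∈-D (inj₁ e-at-0)) start∼
    where
    open Interlaced I
    open Circle B circuit

    D : Subset e[ G ]
    D = ⁅ e ⁆ ∪ ⁅ f ⁆

    open Orbits D

    ∈-D : ∀ {g} → g ≡ e ⊎ g ≡ f → g ∈ D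
    ∈-D (inj₁ refl) = x∈p∪q⁺ (inj₁ (x∈⁅x⁆ _))
    ∈-D (inj₂ refl) = x∈p∪q⁺ (inj₂ (x∈⁅x⁆ _))

    ∈-D⁻ : ∀ {g} → g ∈ D → g ≡ e ⊎ g ≡ f
    ∈-D⁻ g∈D with x∈p∪q⁻ ⁅ e ⁆ ⁅ f ⁆ g∈D
    ... | inj₁ g∈ = inj₁ (x∈⁅y⁆⇒x≡y e g∈)
    ... | inj₂ g∈ = inj₂ (x∈⁅y⁆⇒x≡y f g∈)

    tight-D : Tight D
    tight-D = tight-⊆ D⊆A tight
      where
      D⊆A : D ⊆ A
      D⊆A g∈D with ∈-D⁻ g∈D
      ... | inj₁ refl = e∈A
      ... | inj₂ refl = f∈A

    j<p = ℕ.<-trans j<k k<period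
    i<p = ℕ.<-trans i<j j<p
    0<p = ℕ.<-trans 0<i i<p

    chord-e : Chord 0 j
    chord-e = tight⇒chord (tight-⁅⁆ e∈A tight) 0<p j<p (ℕ.<⇒≢ (ℕ.<-trans 0<i i<j)) e-at-0 e-at-j

    chord-f : Chord i k
    chord-f = tight⇒chord (tight-⁅⁆ f∈A tight) i<p k<period (ℕ.<⇒≢ (ℕ.<-trans i<j j<k)) f-at-i f-at-k

    -- Positions `0` and `j` exhaust the ends of `e`, and `i` and `k` those of `f`.
    free : ∀ {w} → w < period → w ≢ 0 → w ≢ i → w ≢ j → w ≢ k → edge (P w) ∉ D
    free w<p w≢0 w≢i w≢j w≢k w∈D with ∈-D⁻ w∈D
    ... | inj₁ w≡e = edge-at-most-twice 0<p j<p w<p (ℕ.<⇒≢ (ℕ.<-trans 0<i i<j)) (w≢0 ∘ sym) (w≢j ∘ sym)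
                       (trans e-at-j (sym e-at-0)) (trans w≡e (sym e-at-0))
    ... | inj₂ w≡f = edge-at-most-twice i<p k<period w<p (ℕ.<⇒≢ (ℕ.<-trans i<j j<k)) (w≢i ∘ sym) (w≢k ∘ sym)
                       (trans f-at-k (sym f-at-i)) (trans w≡f (sym f-at-i))

    run-ij : acrossEnd (P i) ∼[ D ] P j
    run-ij = run D i<j λ i<w w<j → free (ℕ.<-trans w<j j<p)
      (ℕ.<⇒≢ (ℕ.<-trans 0<i i<w) ∘ sym) (ℕ.<⇒≢ i<w ∘ sym) (ℕ.<⇒≢ w<j) (ℕ.<⇒≢ (ℕ.<-trans w<j j<k))

    run-jk : acrossEnd (P j) ∼[ D ] P k
    run-jk = run D j<k λ j<w w<k → free (ℕ.<-trans w<k k<period)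
      (ℕ.<⇒≢ (ℕ.<-trans 0<i (ℕ.<-trans i<j j<w)) ∘ sym) (ℕ.<⇒≢ (ℕ.<-trans i<j j<w) ∘ sym)
      (ℕ.<⇒≢ j<w ∘ sym) (ℕ.<⇒≢ w<k)

    chord∼ : ∀ {l m} → edge (P l) ≡ e ⊎ edge (P l) ≡ f → Chord l m → P l ∼[ D ] acrossEnd (P m)
    chord∼ l∈ ch = ∼-trans (along∼ _ (∈-D l∈)) (∼-reflexive (sides ch))

    start∼ : P 0 ∼[ D ] acrossEnd (P 0)
    start∼ = ∼-trans (chord∼ (inj₁ e-at-0) chord-e)
      (∼-trans run-jk (∼-trans (chord∼ (inj₂ f-at-k) (chord-sym chord-f))
      (∼-trans run-ij (chord∼ (inj₁ e-at-j) (chord-sym chord-e)))))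

  Noncrossing : Subset e[ G ] → Set
  Noncrossing A = ∀ {e f} → e ∈ A → f ∈ A → e ≢ f → ¬ Interlaced B e f

  Untwisted : Subset e[ G ] → Set
  Untwisted A = ∀ {e} → e ∈ A → Tight ⁅ e ⁆

  module _ {c₀ : Corner e[ G ]} {p : ℕ} (circuit : Circuit G c₀ p) where

    open Circle B circuit
    open Circuit circuit

    -- A chord leaving the interval would cross the one from `l` to `r` and so be interlaced with
    -- it. It cannot end at `l` or `r` either, as that ribbon would then have a third position.
    chord-nests : ∀ {A} → Noncrossing A → ∀ {l r} → l < r → r < p → Chord l r → edge (P l) ∈ A →
                  ∀ {w w′} → l < w → w < r → w′ < p → edge (P w) ∈ A → Chord w w′ → l < w′ × w′ < r
    chord-nests noncrossing {l} {r} l<r r<p lr l∈A {w} {w′} l<w w<r w′<p w∈A ww′ = l<w′ , w′<r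
      where
      l<p = ℕ.<-trans l<r r<p
      w<p = ℕ.<-trans w<r r<p

      distinct : edge (P l) ≢ edge (P w)
      distinct eq = edge-at-most-twice l<p r<p w<p (ℕ.<⇒≢ l<r) (ℕ.<⇒≢ l<w) (ℕ.<⇒≢ w<r ∘ sym)
        (sym (chord-edge lr)) (sym eq)

      l<w′ : l < w′
      l<w′ with ℕ.<-cmp l w′
      ... | tri< l<w′ _ _ = l<w′
      ... | tri≈ _ refl _ = contradiction (sym (chord-edge ww′)) distinct
      ... | tri> _ _ w′<l = contradiction
        (crossing⇒interlaced w′<l l<w w<r r<p (sym (chord-edge ww′)) (chord-edge lr))
        (noncrossing (subst (_∈ _) (chord-edge ww′) w∈A) l∈A
          (λ eq → distinct (trans (sym eq) (sym (chord-edge ww′)))))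

      w′<r : w′ < r
      w′<r with ℕ.<-cmp w′ r
      ... | tri< w′<r _ _ = w′<r
      ... | tri≈ _ refl _ = contradiction
        (trans (chord-edge lr) (sym (chord-edge ww′))) distinct
      ... | tri> _ _ r<w′ = contradiction
        (crossing⇒interlaced l<w w<r r<w′ w′<p (chord-edge lr) (chord-edge ww′))
        (noncrossing l∈A w∈A distinct)

    -- The boundary of (V , A) entering an interval that chords of A do not leave
    -- skips every outermost chord and comes out at the far end.
    traverse : ∀ {A} → Noncrossing A → Untwisted A → ∀ k {t u} → u ≤ k + t → t < u → u < p →
               (∀ {w w′} → t < w → w < u → w′ < p → edge (P w) ∈ A → Chord w w′ → t < w′ × w′ < u) →
               acrossEnd (P t) ∼[ A ] P u
    -- The fuel bounds the distance from `t` to `u`, which is positive.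
    traverse noncrossing untwisted zero u≤t t<u _ _ = contradiction t<u (ℕ.≤⇒≯ u≤t)
    traverse {A} noncrossing untwisted (suc k) {t} {u} u≤ t<u u<p closed with ℕ.m≤n⇒m<n∨m≡n t<u
    ... | inj₂ refl = Orbits.arc∼ A _
    ... | inj₁ s<u  = ∼-trans (arc∼ _) onward
      where
      open Orbits A
      s = suc t

      s<p = ℕ.<-trans s<u u<p
      t<s = ℕ.n<1+n t
      u≤k+s = subst (u ≤_) (sym (ℕ.+-suc k t)) u≤

      onward : P s ∼[ A ] P u
      onward with edge (P s) ∈? A
      ... | no s∉A = ∼-trans (across∼ (P s) s∉A) (traverse noncrossing untwisted k u≤k+s s<u u<p closed′)
        where
        closed′ : ∀ {w w′} → s < w → w < u → w′ < p → edge (P w) ∈ A → Chord w w′ → s < w′ × w′ < u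
        closed′ {w} {w′} s<w w<u w′<p w∈A ww′ with closed (ℕ.<-trans t<s s<w) w<u w′<p w∈A ww′
        ... | t<w′ , w′<u with ℕ.m≤n⇒m<n∨m≡n t<w′
        ...   | inj₁ s<w′ = s<w′ , w′<u
        ...   | inj₂ refl = contradiction (subst (_∈ A) (chord-edge ww′) w∈A) s∉A
      -- The ribbon at `s` leads to its other end `s′` further on in the interval, skipping
      -- everything between the two.
      ... | yes s∈A with partner (untwisted s∈A) s<p
      ...   | s′ , s′<p , ss′ = ∼-trans (along∼ (P s) s∈A) (∼-trans (∼-reflexive (sides ss′))
        (traverse noncrossing untwisted k (ℕ.≤-trans u≤k+s (ℕ.+-monoʳ-≤ k (ℕ.<⇒≤ s<s′))) s′<u u<p closed′))
        where
        s′<u : s′ < u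
        s′<u = proj₂ (closed t<s s<u s′<p s∈A ss′)

        s<s′ : s < s′
        s<s′ = ℕ.≤∧≢⇒< (proj₁ (closed t<s s<u s′<p s∈A ss′)) (chord-≢ ss′)

        closed′ : ∀ {w w′} → s′ < w → w < u → w′ < p → edge (P w) ∈ A → Chord w w′ → s′ < w′ × w′ < u
        closed′ {w} {w′} s′<w w<u w′<p w∈A ww′ = s′<w′ , proj₂ w′∈
          where
          w<p = ℕ.<-trans w<u u<p
          w′∈ = closed (ℕ.<-trans t<s (ℕ.<-trans s<s′ s′<w)) w<u w′<p w∈A ww′

          -- A chord starting beyond `s′` cannot end at `s` or `s′`, which are partners of each
          -- other, nor between them, since chords starting there stay there.
          s′<w′ : s′ < w′
          s′<w′ with ℕ.<-cmp s w′ | ℕ.<-cmp s′ w′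
          ... | _ | tri< s′<w′ _ _ = s′<w′
          ... | _ | tri≈ _ refl _ = contradiction
            (chord-unique s<p w<p (chord-sym ss′) (chord-sym ww′))
            (ℕ.<⇒≢ (ℕ.<-trans s<s′ s′<w))
          ... | tri≈ _ refl _ | _ = contradiction
            (chord-unique s′<p w<p ss′ (chord-sym ww′)) (ℕ.<⇒≢ s′<w)
          ... | tri> _ _ w′<s | _ = contradiction w′<s (ℕ.≤⇒≯ (proj₁ w′∈))
          ... | tri< s<w′ _ _ | tri> _ _ w′<s′ = contradiction
            (proj₂ (chord-nests noncrossing s<s′ s′<p ss′ s∈A s<w′ w′<s′ w<p
              (subst (_∈ A) (chord-edge ww′) w∈A) (chord-sym ww′)))
            (ℕ.<⇒≯ s′<w)

    module _ {A : Subset e[ G ]} (noncrossing : Noncrossing A) (untwisted : Untwisted A)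
             {u : ℕ} (0<u : 0 < u) (u<p : u < p) (chord : Chord 0 u) (start∈A : edge c₀ ∈ A) where

      -- The corners on the arcs between the ends at 0 and u, hence on one side of the chord.
      Within : Corner e[ G ] → Set
      Within c = (∃ λ w → w < u × c ≡ acrossEnd (P w)) ⊎ (∃ λ w → w < u × c ≡ P (suc w))

      within-arc : ∀ {c} → Within c → Within (arc G c)
      within-arc (inj₁ (w , w<u , refl)) = inj₂ (w , w<u , refl)
      within-arc (inj₂ (w , w<u , refl)) = inj₁ (w , w<u , arc-P-suc w)

      within-P : ∀ {w} → 0 < w → w ≤ u → Within (P w)
      within-P {suc w} _ w<u = inj₂ (w , w<u , refl)

      end∈A : edge (P u) ∈ A
      end∈A = subst (_∈ A) (chord-edge chord) start∈A

      nested : ∀ {w w′} → 0 < w → w < u → w′ < p → edge (P w) ∈ A → Chord w w′ → 0 < w′ × w′ < u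
      nested = chord-nests noncrossing 0<u u<p chord start∈A

      -- The sides of the outer chord exchange the extreme corners `acrossEnd c₀` and `P u`. At an
      -- inner position the boundary crosses the end or follows a chord that `nested` keeps inside.
      within-turn : ∀ {c} → Within c → Within (turn A c)
      within-turn (inj₁ (zero , _ , refl)) =
        subst Within (sym (trans (turn-∈ {c = acrossEnd c₀} start∈A) (chord-opposite chord)))
          (within-P 0<u ℕ.≤-refl)
      within-turn (inj₁ (w@(suc _) , w<u , refl)) with edge (P w) ∈? A
      ... | no  w∉A = subst Within
        (sym (trans (turn-∉ {c = acrossEnd (P w)} w∉A) (acrossEnd-involutive (P w))))
        (within-P (s≤s z≤n) (ℕ.<⇒≤ w<u))
      ... | yes w∈A with partner (untwisted w∈A) (ℕ.<-trans w<u u<p)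
      ...   | w′ , w′<p , ww′ with nested (s≤s z≤n) w<u w′<p w∈A ww′
      ...     | 0<w′ , w′<u = subst Within
        (sym (trans (turn-∈ {c = acrossEnd (P w)} w∈A) (chord-opposite ww′)))
        (within-P 0<w′ (ℕ.<⇒≤ w′<u))
      within-turn (inj₂ (v , v<u , refl)) with ℕ.m≤n⇒m<n∨m≡n v<u
      ... | inj₂ refl = subst Within (sym (trans (turn-∈ {c = P u} end∈A) (sides (chord-sym chord))))
        (inj₁ (0 , 0<u , refl))
      ... | inj₁ w<u with edge (P (suc v)) ∈? A
      ...   | no  w∉A = subst Within (sym (turn-∉ {c = P (suc v)} w∉A)) (inj₁ (suc v , w<u , refl))
      ...   | yes w∈A with partner (untwisted w∈A) (ℕ.<-trans w<u u<p)
      ...     | w′ , w′<p , ww′ = subst Within (sym (trans (turn-∈ {c = P (suc v)} w∈A) (sides ww′)))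
        (inj₁ (w′ , proj₂ (nested (s≤s z≤n) w<u w′<p w∈A ww′) , refl))

      -- `Within` is a union of boundary components containing `acrossEnd c₀`. It misses `c₀`, which
      -- is neither the flip of a position nor met again at positions 1 to `u`.
      start-separated : ¬ acrossEnd c₀ ∼[ A ] c₀
      start-separated r
        with orbit-invariant (arc-involutive G) (turn-involutive A) {Within}
               within-arc within-turn r (inj₁ (0 , 0<u , refl))
      ... | inj₁ (w , _ , eq)   = P≢acrossEnd-P 0 w eq
      ... | inj₂ (w , w<u , eq) = first (s≤s z≤n) (ℕ.≤-<-trans w<u u<p) (sym eq)

  noncrossing-remove : ∀ {A e} → Noncrossing A → Noncrossing (A - e)
  noncrossing-remove noncrossing e∈ f∈ = noncrossing (x∈p-y⇒x∈p e∈) (x∈p-y⇒x∈p f∈)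

  untwisted-remove : ∀ {A e} → Untwisted A → Untwisted (A - e)
  untwisted-remove untwisted e∈ = untwisted (x∈p-y⇒x∈p e∈)

  module _ {c₀ : Corner e[ G ]} {p : ℕ} (circuit : Circuit G c₀ p) {A : Subset e[ G ]}
           (noncrossing : Noncrossing A) (untwisted : Untwisted A) (e∈A : edge c₀ ∈ A)
           {u : ℕ} (u<p : u < p) (chord : Circle.Chord B circuit 0 u) where

    private
      e = edge c₀

    open Circle B circuit
    open Orbits (A - e)
    open Orbits A using () renaming (∼-sym to ∼-symA; ∼-fold to ∼-foldA)

    e∉A-e : e ∉ A - e
    e∉A-e e∈ = x∈p-y⇒x≢y e∈ refl

    0<u : 0 < u
    0<u = ℕ.≤∧≢⇒< z≤n (chord-≢ chord)

    end∼ : acrossEnd c₀ ∼[ A - e ] P u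
    end∼ = traverse circuit {A - e} (noncrossing-remove {A} noncrossing) (untwisted-remove {A} untwisted)
      u (ℕ.m≤m+n u 0) 0<u u<p λ 0<w w<u w′<p w∈ →
        chord-nests circuit noncrossing 0<u u<p chord e∈A 0<w w<u w′<p (x∈p-y⇒x∈p w∈)

    -- In `A - e` the ends of `e` are crossed, and `end∼` links one end to the other.
    start∼ : ∀ {d} → SameRibbon c₀ d → c₀ ∼[ A - e ] d
    start∼ same     = ∼-refl
    start∼ across   = across∼ c₀ e∉A-e
    start∼ opposite = ∼-trans (across∼ c₀ e∉A-e)
      (∼-trans end∼ (∼-reflexive (sym (chord-opposite chord))))
    start∼ along    = ∼-trans (start∼ opposite) (∼-sym (across∼ (alongSide c₀) e∉A-e))

    A⇒A-e : ∀ {c d} → c ∼[ A ] d → c ∼[ A - e ] d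
    A⇒A-e = ∼-foldA (IsDecEquivalence.isEquivalence (decE (A - e))) arc∼ along′
      (λ d d∉A → across∼ d (d∉A ∘ x∈p-y⇒x∈p))
      where
      along′ : ∀ d → edge d ∈ A → d ∼[ A - e ] alongSide d
      along′ d d∈A with edge d Fin.≟ e
      ... | yes d≡e =
        ∼-trans (∼-sym (start∼ (sameRibbon c₀ d d≡e))) (start∼ (sameRibbon c₀ (alongSide d) d≡e))
      ... | no  d≢e = along∼ d (x∈p∧x≢y⇒x∈p-y d∈A d≢e)

    -- The components for `A` refine those for `A - e`, and `c₀` and `acrossEnd c₀` are separated
    -- for `A` but joined for `A - e`.
    chord-separates : bc (A - e) < bc A
    chord-separates = ℕ.+-monoʳ-< (isolated G)
      (classes-mono-< (decE A) (decE (A - e)) A⇒A-e (across∼ c₀ e∉A-e)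
        (start-separated circuit noncrossing untwisted 0<u u<p chord e∈A ∘ ∼-symA))

  bc-remove-< : ∀ {A e} → Noncrossing A → Untwisted A → e ∈ A → bc (A - e) < bc A
  bc-remove-< {A} {e} noncrossing untwisted e∈A =
    -- Starting at a corner of `e` places that ribbon at position 0.
    let p , circuit = circuit-from (e , false , false)
        u , u<p , chord = Circle.partner B circuit {0} (untwisted e∈A) (Circuit.positive circuit)
    in chord-separates circuit noncrossing untwisted e∈A u<p chord

  noncrossing⇒tight : ∀ {A} → Noncrossing A → Untwisted A → Tight A
  noncrossing⇒tight {A} = go (⊂-wellFounded A)
    where
    open ℕ.≤-Reasoning
    go : ∀ {A} → Acc _⊂_ A → Noncrossing A → Untwisted A → Tight A
    go {A} (acc rec) noncrossing untwisted with nonempty? A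
    ... | yes (e , e∈A) = begin
      suc ∣ A ∣           ≤⟨ s≤s (∣p∣≤1+∣p-x∣ A e) ⟩
      suc (suc ∣ A - e ∣) ≤⟨ s≤s (go (rec (x∈p⇒p-x⊂p e∈A))
                                  (noncrossing-remove noncrossing) (untwisted-remove untwisted)) ⟩
      suc (bc (A - e))    ≤⟨ bc-remove-< noncrossing untwisted e∈A ⟩
      bc A                ∎
    ... | no empty with refl ← Empty-unique empty = begin
      suc ∣ ⊥ {e[ G ]} ∣ ≡⟨ cong suc (∣⊥∣≡0 e[ G ]) ⟩
      1                  ≡⟨ bc-⊥ ⟨
      bc ⊥               ∎

-- The constant term

module _ where

  open import Data.Integer using (+_)

  eulerGenus-0 : ∀ v e f → + 2 ℤ.- (+ v ℤ.- + e ℤ.+ + f) ≡ 0ℤ ⇔ v ℕ.+ f ≡ 2 ℕ.+ e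
  eulerGenus-0 v e f = mk⇔
    (λ eq → sym (ℤ.+-injective (ℤ.i-j≡0⇒i≡j (+ (2 ℕ.+ e)) (+ (v ℕ.+ f)) (trans (sym moved) eq))))
    (λ eq → trans moved (ℤ.i≡j⇒i-j≡0 (cong +_ (sym eq))))
    where
    rearrange : ∀ V E F → + 2 ℤ.- (V ℤ.- E ℤ.+ F) ≡ (+ 2 ℤ.+ E) ℤ.- (V ℤ.+ F)
    rearrange = solve 3 (λ V E F → con (+ 2) :- (V :- E :+ F) := (con (+ 2) :+ E) :- (V :+ F)) refl
      where open +-*-Solver

    moved : + 2 ℤ.- (+ v ℤ.- + e ℤ.+ + f) ≡ + (2 ℕ.+ e) ℤ.- + (v ℕ.+ f)
    moved = rearrange (+ v) (+ e) (+ f)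

z^-≢0 : ∀ m → (z^ m) 0ℤ ≢ 0 ⇔ m ≡ 0ℤ
z^-≢0 m with m ℤ.≟ 0ℤ
... | yes m≡0 = mk⇔ (λ _ → m≡0) (λ _ ())
... | no  m≢0 = mk⇔ (λ 0≢0 → contradiction refl 0≢0) (λ m≡0 → contradiction m≡0 m≢0)

sum-≢0 : (h : X → ℕ) (xs : List X) → sum (List.map h xs) ≢ 0 ⇔ Any (λ x → h x ≢ 0) xs
sum-≢0 h xs = mk⇔ (to xs) from
  where
  to : ∀ xs → sum (List.map h xs) ≢ 0 → Any (λ x → h x ≢ 0) xs
  to []       0≢0 = contradiction refl 0≢0
  to (x ∷ xs) s≢0 with h x ℕ.≟ 0
  ... | yes hx≡0 = there (to xs (s≢0 ∘ trans (cong (_+ sum (List.map h xs)) hx≡0)))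
  ... | no  hx≢0 = here hx≢0

  from : ∀ {xs} → Any (λ x → h x ≢ 0) xs → sum (List.map h xs) ≢ 0
  from {x ∷ xs} (here hx≢0) = hx≢0 ∘ ℕ.m+n≡0⇒m≡0 (h x)
  from {x ∷ xs} (there p)   = from p ∘ ℕ.m+n≡0⇒n≡0 (h x)

∈-subsets : (A : Subset n) → A ∈ˡ subsets n
∈-subsets []            = here refl
∈-subsets (false ∷ A)   = ∈-++⁺ˡ (∈-map⁺ (outside ∷_) (∈-subsets A))
∈-subsets (true ∷ A)    = ∈-++⁺ʳ _ (∈-map⁺ (inside ∷_) (∈-subsets A))

module _ (B : Bouquet) where

  open Tightness B
  open Boundary G
  open Criterion B

  ∣A∣+∣∁A∣≡n : (A : Subset e[ G ]) → ∣ A ∣ + ∣ ∁ A ∣ ≡ e[ G ]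
  ∣A∣+∣∁A∣≡n A = trans (cong (∣ A ∣ +_) (∣∁p∣≡n∸∣p∣ A)) (ℕ.m+[n∸m]≡n (∣p∣≤n A))

  2+e≡ : ∀ A → 2 + e[ G ] ≡ suc ∣ A ∣ + suc ∣ ∁ A ∣
  2+e≡ A = trans (cong (2 +_) (sym (∣A∣+∣∁A∣≡n A))) (sym (cong suc (ℕ.+-suc ∣ A ∣ ∣ ∁ A ∣)))

  genus-0⇔tight : ∀ A → eulerGenus (partialDual G A) ≡ 0ℤ ⇔ (Tight A × Tight (∁ A))
  genus-0⇔tight A rewrite v-partialDual G A | f-partialDual G A = mk⇔
    (λ eq → tight (Equivalence.to (eulerGenus-0 _ _ _) eq))
    (λ (tight-A , tight-∁A) → Equivalence.from (eulerGenus-0 (bc A) e[ G ] (bc (∁ A)))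
      (trans
        (cong₂ _+_ (ℕ.≤-antisym (bc≤1+∣A∣ A) tight-A) (ℕ.≤-antisym (bc≤1+∣A∣ (∁ A)) tight-∁A))
        (sym (2+e≡ A))))
    where
    open ℕ.≤-Reasoning
    tight : bc A + bc (∁ A) ≡ 2 + e[ G ] → Tight A × Tight (∁ A)
    tight eq =
      ℕ.+-cancelʳ-≤ (suc ∣ ∁ A ∣) _ _ (begin
        suc ∣ A ∣ + suc ∣ ∁ A ∣ ≡⟨ trans eq (2+e≡ A) ⟨
        bc A + bc (∁ A)         ≤⟨ ℕ.+-monoʳ-≤ (bc A) (bc≤1+∣A∣ (∁ A)) ⟩
        bc A + suc ∣ ∁ A ∣      ∎) ,
      ℕ.+-cancelˡ-≤ (suc ∣ A ∣) _ _ (begin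
        suc ∣ A ∣ + suc ∣ ∁ A ∣ ≡⟨ trans eq (2+e≡ A) ⟨
        bc A + bc (∁ A)         ≤⟨ ℕ.+-monoˡ-≤ (bc (∁ A)) (bc≤1+∣A∣ A) ⟩
        suc ∣ A ∣ + bc (∁ A)    ∎)

  -- Coefficients are natural numbers, so nothing cancels: the term is nonzero as soon as one
  -- partial dual has genus zero.
  constantTerm⇔tight : constantTerm (∂ε G) ≢ 0 ⇔ ∃ λ A → Tight A × Tight (∁ A)
  constantTerm⇔tight = mk⇔ to from
    where
    h : Subset e[ G ] → ℕ
    h A = (z^ eulerGenus (partialDual G A)) 0ℤ

    to : constantTerm (∂ε G) ≢ 0 → ∃ λ A → Tight A × Tight (∁ A)
    to c≢0 with A , _ , hA≢0 ← find (Equivalence.to (sum-≢0 h (subsets e[ G ])) c≢0) =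
      A , Equivalence.to (genus-0⇔tight A) (Equivalence.to (z^-≢0 _) hA≢0)

    from : (∃ λ A → Tight A × Tight (∁ A)) → constantTerm (∂ε G) ≢ 0
    from (A , tights) = Equivalence.from (sum-≢0 h (subsets e[ G ]))
      (lose (∈-subsets A) (Equivalence.from (z^-≢0 _) (Equivalence.from (genus-0⇔tight A) tights)))

  -- The boundary count is at least 1, so a count other than 1 is at least 2, which is tightness for
  -- a singleton.
  sign-+⇔tight : ∀ e → sign (SI B) e ≡ Sign.+ ⇔ Tight ⁅ e ⁆
  sign-+⇔tight e with twisted? B e
  ... | yes tw = mk⇔ (λ ())
    (λ tight → contradiction (subst₂ _<_ (∣⁅x⁆∣≡1 e) tw tight) (ℕ.<-irrefl refl))
  ... | no ¬tw = mk⇔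
    (λ _ → subst (_< bc ⁅ e ⁆) (sym (∣⁅x⁆∣≡1 e)) (ℕ.≤∧≢⇒< 1≤bc (¬tw ∘ sym)))
    (λ _ → refl)
    where
    1≤bc : 1 ≤ bc ⁅ e ⁆
    1≤bc = ℕ.≤-trans (classes-positive (decE ⁅ e ⁆) (e , false , false)) (ℕ.m≤n+m _ (isolated G))

-- Two-colourings and complementary tight sets

theorem17 : (SG : SignedGraph) (sig : IsSignedIntersectionGraph SG) →
    constantTerm (IP SG sig) ≢ 0 ⇔ (Positive SG × Bipartite SG)
theorem17 SG (B , iso) = mk⇔
  (λ c≢0 → let A , tight , tight-∁ = Equivalence.to (constantTerm⇔tight B) c≢0 in
    positive A tight tight-∁ , lookup A ∘ to , λ {u} {v} → colouring A tight tight-∁ {u} {v})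
  (λ (+ve , colour , proper) → Equivalence.from (constantTerm⇔tight B)
    -- One colour class, moved to the edges of `B`; properness makes it and its complement
    -- noncrossing.
    (tabulate (colour ∘ from) ,
     noncrossing⇒tight (noncrossing proper) (untwisted +ve) ,
     noncrossing⇒tight (noncrossing-∁ proper) (untwisted +ve)))
  where
  open _≅_ iso
  open Inverse vertices using (from; strictlyInverseˡ)
  open Tightness B
  open Criterion B

  tight-edge : ∀ A → Tight A → Tight (∁ A) → ∀ e → Tight ⁅ e ⁆
  tight-edge A tight tight-∁ e with e ∈? A
  ... | yes e∈A = tight-⁅⁆ e∈A tight
  ... | no  e∉A = tight-⁅⁆ (x∉p⇒x∈∁p e∉A) tight-∁

  positive : ∀ A → Tight A → Tight (∁ A) → Positive SG
  positive A tight tight-∁ u = trans (sign-≡ u)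
    (Equivalence.from (sign-+⇔tight B (to u)) (tight-edge A tight tight-∁ (to u)))

  colouring : ∀ A → Tight A → Tight (∁ A) → ∀ {u v} → Adj SG u v → lookup A (to u) ≢ lookup A (to v)
  colouring A tight tight-∁ {u} {v} uv eq with Equivalence.to (adj-⇔ u v) uv | to u ∈? A
  ... | e≢f , I | yes e∈A = tight⇒¬interlaced tight e∈A
    (lookup⇒[]= (to v) A (trans (sym eq) ([]=⇒lookup e∈A))) e≢f I
  ... | e≢f , I | no  e∉A = tight⇒¬interlaced tight-∁ (x∉p⇒x∈∁p e∉A)
    (x∉p⇒x∈∁p λ f∈A → e∉A (lookup⇒[]= (to u) A (trans eq ([]=⇒lookup f∈A)))) e≢f I

  adjacent : ∀ {e f} → e ≢ f → Interlaced B e f → Adj SG (from e) (from f)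
  adjacent {e} {f} e≢f I = Equivalence.from (adj-⇔ (from e) (from f))
    (subst₂ (Adj (SI B)) (sym (strictlyInverseˡ e)) (sym (strictlyInverseˡ f)) (e≢f , I))

  untwisted : Positive SG → ∀ {A} → Untwisted A
  untwisted +ve {e = e} _ = Equivalence.to (sign-+⇔tight B e) (begin
    sign (SI B) e              ≡⟨ cong (sign (SI B)) (strictlyInverseˡ e) ⟨
    sign (SI B) (to (from e))  ≡⟨ sign-≡ (from e) ⟨
    sign SG (from e)           ≡⟨ +ve (from e) ⟩
    Sign.+                     ∎)
    where open ≡-Reasoning

  module _ {colour : Fin (order SG) → Bool} (proper : ∀ {u v} → Adj SG u v → colour u ≢ colour v) where

    private
      A : Subset (edges B)
      A = tabulate (colour ∘ from)

      colour-∈ : ∀ {e} → e ∈ A → colour (from e) ≡ true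
      colour-∈ {e} e∈A = trans (sym (lookup∘tabulate (colour ∘ from) e)) ([]=⇒lookup e∈A)

      colour-∁ : ∀ {e} → e ∈ ∁ A → colour (from e) ≡ false
      colour-∁ {e} e∈∁A = Bool.¬-not λ eq →
        x∈∁p⇒x∉p e∈∁A (lookup⇒[]= e A (trans (lookup∘tabulate (colour ∘ from) e) eq))

    noncrossing : Noncrossing A
    noncrossing e∈A f∈A e≢f I = proper (adjacent e≢f I) (trans (colour-∈ e∈A) (sym (colour-∈ f∈A)))

    noncrossing-∁ : Noncrossing (∁ A)
    noncrossing-∁ e∈∁A f∈∁A e≢f I = proper (adjacent e≢f I) (trans (colour-∁ e∈∁A) (sym (colour-∁ f∈∁A)))
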